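{- Let $G$ be a finite abelian group of order $h$, written additively, and let $S = (r_1^{e_1}, r_2^{e_2}, \dots, r_g^{e_g})$ be a sequence in $G$, where each $r_i$ is an element of $G$ with multiplicity $e_i$. The number $n(S)$ of zero-sum subsequences of $S$ is given by $$n(S) = \frac{1}{h} \sum_{\chi \in \hat{G}} \prod_{i=1}^{g} \left( \sum_{k=0}^{e_i} \chi(r_i)^k \right),$$ where $\hat{G}$ is the dual group of characters of $G$.
   Context: $\hat{G}$ is the group of all group homomorphisms $\chi : G \to \mathbb{C}^*$. The notation $S = (r_1^{e_1}, \dots, r_g^{e_g})$ means the sequence in which $r_i$ is repeated $e_i$ times ($e_i$ a non-negative integer). Subsequences of $S$ are represented by (and counted as) tuples of exponents $(f_1, \dots, f_g)$ of integers with $0 \le f_i \le e_i$ for all $i$; the subsequence is zero-sum if $\sum_{i=1}^{g} f_i r_i = 0_G$, where $0_G$ is the identity of $G$. The empty subsequence (all $f_i = 0$) is included and counted as zero-sum. Thus $n(S)$ is the number of tuples $(f_1,\dots,f_g)$ with $0 \le f_i \le e_i$ and $\sum_{i=1}^g f_i r_i = 0_G$. -}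

module Defs where

open import Algebra.Bundles using (AbelianGroup; CommutativeRing; RawGroup; Semiring)
import Algebra.Definitions.RawMonoid as RawMonoid
import Algebra.Definitions.RawSemiring as RawSemiring
open import Algebra.Morphism.Bundles using (GroupHomomorphism)
open import Data.Fin.Base using (Fin)
open import Data.Fin.Properties using (nonZeroIndex) renaming (_≟_ to _≟ᶠ_)
open import Data.Integer.Base using (+_)
open import Data.List.Base using (List; [_]; length; filter; upTo; cartesianProductWith)
open import Data.Nat.Base as ℕ using (ℕ; zero; suc; _⊔_)
import Data.Nat.Properties as ℕₚ
open import Data.Product.Base using (∃; _×_; _,_)
open import Data.Rational.Base as ℚ
  using (ℚ; 0ℚ; 1ℚ; ½; ∣_∣; Positive; positive)
import Data.Rational.Properties as ℚₚ
open import Data.Rational.Solver using (module +-*-Solver)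
open import Data.Vec.Functional as Vector using (Vector)
open import Function.Base using (_∘_)
open import Function.Bundles using (Inverse)
open import Function.Properties.Inverse using (Inverse⇒Injection)
open import Level using (Level; 0ℓ) renaming (_⊔_ to _⊔ˡ_)
open import Relation.Binary.Bundles using (Setoid)
open import Relation.Binary.Definitions using (Decidable)
open import Relation.Binary.PropositionalEquality as ≡ using (_≡_; refl; cong; subst; sym; trans)
open import Relation.Binary.Structures using (IsEquivalence)
open import Relation.Nullary.Decidable using (via-injection)

open +-*-Solver using (solve; con; _:=_; _:+_; _:*_; _:-_; :-_)

private
  variable
    c ℓ : Level

-- Real numbers are Cauchy sequences of rationals, with a modulus given by the
-- witness in Cauchy, up to the setoid equality _≈ᴿ_ (null difference).

Seq : Set
Seq = ℕ → ℚ

Cauchy : Seq → Set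
Cauchy a = ∀ ε → 0ℚ ℚ.< ε →
  ∃ λ N → ∀ m n → N ℕ.≤ m → N ℕ.≤ n → ∣ a m ℚ.- a n ∣ ℚ.< ε

infix 4 _~_
_~_ : Seq → Seq → Set
a ~ b = ∀ ε → 0ℚ ℚ.< ε →
  ∃ λ N → ∀ n → N ℕ.≤ n → ∣ a n ℚ.- b n ∣ ℚ.< ε

record ℝ : Set where
  constructor mkℝ
  field
    seq    : Seq
    cauchy : Cauchy seq

open ℝ public

infix 4 _≈ᴿ_
record _≈ᴿ_ (x y : ℝ) : Set where
  constructor mk≈ᴿ
  field
    seq~ : seq x ~ seq y

open _≈ᴿ_ public

private

  half-pos : ∀ {ε} → 0ℚ ℚ.< ε → 0ℚ ℚ.< ½ ℚ.* ε
  half-pos {ε} 0<ε = subst (ℚ._< ½ ℚ.* ε) (ℚₚ.*-zeroʳ ½) (ℚₚ.*-monoʳ-<-pos ½ 0<ε)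

  half+half : ∀ ε → ½ ℚ.* ε ℚ.+ ½ ℚ.* ε ≡ ε
  half+half = solve 1 (λ ε → con ½ :* ε :+ con ½ :* ε := ε) refl

  dist-self : ∀ p → ∣ p ℚ.- p ∣ ≡ 0ℚ
  dist-self p = cong ∣_∣ (ℚₚ.+-inverseʳ p)

  dist-sym : ∀ p q → ∣ p ℚ.- q ∣ ≡ ∣ q ℚ.- p ∣
  dist-sym p q = trans
    (cong ∣_∣ (solve 2 (λ p q → p :- q := :- (q :- p)) refl p q))
    (ℚₚ.∣-p∣≡∣p∣ (q ℚ.- p))

  sum-bound : ∀ {ε} p q {r} → r ≡ p ℚ.+ q →
              ∣ p ∣ ℚ.< ½ ℚ.* ε → ∣ q ∣ ℚ.< ½ ℚ.* ε → ∣ r ∣ ℚ.< ε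
  sum-bound {ε} p q refl p< q< = ℚₚ.≤-<-trans (ℚₚ.∣p+q∣≤∣p∣+∣q∣ p q)
    (subst (∣ p ∣ ℚ.+ ∣ q ∣ ℚ.<_) (half+half ε) (ℚₚ.+-mono-< p< q<))

  ⊔ˡ-≤ : ∀ {M N n} → M ⊔ N ℕ.≤ n → M ℕ.≤ n
  ⊔ˡ-≤ {M} {N} = ℕₚ.m⊔n≤o⇒m≤o M N

  ⊔ʳ-≤ : ∀ {M N n} → M ⊔ N ℕ.≤ n → N ℕ.≤ n
  ⊔ʳ-≤ {M} {N} = ℕₚ.m⊔n≤o⇒n≤o M N

≗⇒~ : ∀ {a b : Seq} → (∀ n → a n ≡ b n) → a ~ b
≗⇒~ {a} {b} eq ε 0<ε = 0 , λ n _ → subst (ℚ._< ε)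
  (sym (trans (cong (λ p → ∣ p ℚ.- b n ∣) (eq n)) (dist-self (b n)))) 0<ε

~-sym : ∀ {a b} → a ~ b → b ~ a
~-sym {a} {b} a~b ε 0<ε =
  let N , f = a~b ε 0<ε
  in N , λ n N≤n → subst (ℚ._< ε) (dist-sym (a n) (b n)) (f n N≤n)

~-trans : ∀ {a b d} → a ~ b → b ~ d → a ~ d
~-trans {a} {b} {d} a~b b~d ε 0<ε =
  let M , f = a~b (½ ℚ.* ε) (half-pos 0<ε)
      N , g = b~d (½ ℚ.* ε) (half-pos 0<ε)
  in M ⊔ N , λ n le → sum-bound (a n ℚ.- b n) (b n ℚ.- d n)
  (solve 3 (λ x y z → x :- z := (x :- y) :+ (y :- z)) refl (a n) (b n) (d n))
  (f n (⊔ˡ-≤ le)) (g n (⊔ʳ-≤ le))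

≈ᴿ-isEquivalence : IsEquivalence _≈ᴿ_
≈ᴿ-isEquivalence = record
  { refl  = λ {x} → mk≈ᴿ (≗⇒~ {seq x} (λ _ → refl))
  ; sym   = λ {x} {y} p → mk≈ᴿ (~-sym {seq x} {seq y} (seq~ p))
  ; trans = λ {x} {y} {z} p q → mk≈ᴿ (~-trans {seq x} {seq y} {seq z} (seq~ p) (seq~ q))
  }

private

  -- Both the Cauchy property and congruence of an operation reduce to an
  -- estimate between the values of the operation at two pairs of rationals.

  add-close : ∀ ε a b c d → ∣ a ℚ.- c ∣ ℚ.< ½ ℚ.* ε → ∣ b ℚ.- d ∣ ℚ.< ½ ℚ.* ε →
              ∣ (a ℚ.+ b) ℚ.- (c ℚ.+ d) ∣ ℚ.< ε
  add-close ε a b c d = sum-bound (a ℚ.- c) (b ℚ.- d)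
    (solve 4 (λ a b c d → (a :+ b) :- (c :+ d) := (a :- c) :+ (b :- d)) refl a b c d)

  neg-close : ∀ ε a b → ∣ a ℚ.- b ∣ ℚ.< ε → ∣ (ℚ.- a) ℚ.- (ℚ.- b) ∣ ℚ.< ε
  neg-close ε a b = subst (ℚ._< ε) (trans (dist-sym a b)
    (cong ∣_∣ (solve 2 (λ a b → b :- a := (:- a) :- (:- b)) refl a b)))

  *-bound : ∀ B δ p q .{{_ : Positive B}} → ∣ p ∣ ℚ.< B → ∣ q ∣ ℚ.< δ → ∣ p ℚ.* q ∣ ℚ.< B ℚ.* δ
  *-bound B δ p q p< q< = begin-strict
    ∣ p ℚ.* q ∣      ≡⟨ ℚₚ.∣p*q∣≡∣p∣*∣q∣ p q ⟩
    ∣ p ∣ ℚ.* ∣ q ∣  ≤⟨ ℚₚ.*-monoʳ-≤-nonNeg ∣ q ∣ {{ℚ.nonNegative (ℚₚ.0≤∣p∣ q)}} (ℚₚ.<⇒≤ p<) ⟩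
    B ℚ.* ∣ q ∣      <⟨ ℚₚ.*-monoʳ-<-pos B q< ⟩
    B ℚ.* δ          ∎
    where open ℚₚ.≤-Reasoning

  mul-close : ∀ ε B δ .{{_ : Positive B}} → B ℚ.* δ ≡ ½ ℚ.* ε → ∀ a b c d →
              ∣ a ∣ ℚ.< B → ∣ d ∣ ℚ.< B → ∣ a ℚ.- c ∣ ℚ.< δ → ∣ b ℚ.- d ∣ ℚ.< δ →
              ∣ (a ℚ.* b) ℚ.- (c ℚ.* d) ∣ ℚ.< ε
  mul-close ε B δ eq a b c d a< d< ac bd = sum-bound (a ℚ.* (b ℚ.- d)) (d ℚ.* (a ℚ.- c))
    (solve 4 (λ a b c d → (a :* b) :- (c :* d) := a :* (b :- d) :+ d :* (a :- c)) refl a b c d)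
    (subst (∣ a ℚ.* (b ℚ.- d) ∣ ℚ.<_) eq (*-bound B δ a (b ℚ.- d) a< bd))
    (subst (∣ d ℚ.* (a ℚ.- c) ∣ ℚ.<_) eq (*-bound B δ d (a ℚ.- c) d< ac))

  Bounds : Seq → ℚ → ℕ → Set
  Bounds a B N = ∀ n → N ℕ.≤ n → ∣ a n ∣ ℚ.< B

  bound : ∀ {a} → Cauchy a → ∃ λ B → ∃ λ N → Bounds a B N
  bound {a} ca with ca 1ℚ (ℚₚ.positive⁻¹ 1ℚ)
  ... | N , f = 1ℚ ℚ.+ ∣ a N ∣ , N , λ n N≤n → begin-strict
    ∣ a n ∣                          ≡⟨ cong ∣_∣ (solve 2 (λ x y → x := (x :- y) :+ y) refl (a n) (a N)) ⟩
    ∣ (a n ℚ.- a N) ℚ.+ a N ∣        ≤⟨ ℚₚ.∣p+q∣≤∣p∣+∣q∣ (a n ℚ.- a N) (a N) ⟩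
    ∣ a n ℚ.- a N ∣ ℚ.+ ∣ a N ∣      <⟨ ℚₚ.+-monoˡ-< ∣ a N ∣ (f n N N≤n ℕₚ.≤-refl) ⟩
    1ℚ ℚ.+ ∣ a N ∣                   ∎
    where open ℚₚ.≤-Reasoning

  bound-+ˡ : ∀ {a d A D M N} → Bounds a A M → Bounds d D N → Bounds a (A ℚ.+ D) (M ⊔ N)
  bound-+ˡ {d = d} {A} {D} {N = N} f g n le = ℚₚ.<-≤-trans (f n (⊔ˡ-≤ le))
    (subst (ℚ._≤ A ℚ.+ D) (ℚₚ.+-identityʳ A)
      (ℚₚ.+-monoʳ-≤ A (ℚₚ.≤-trans (ℚₚ.0≤∣p∣ (d N)) (ℚₚ.<⇒≤ (g N ℕₚ.≤-refl)))))

  bound-+ʳ : ∀ {a d A D M N} → Bounds a A M → Bounds d D N → Bounds d (A ℚ.+ D) (M ⊔ N)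
  bound-+ʳ {a} {A = A} {D} {M} f g n le = ℚₚ.<-≤-trans (g n (⊔ʳ-≤ le))
    (subst (ℚ._≤ A ℚ.+ D) (ℚₚ.+-identityˡ D)
      (ℚₚ.+-monoˡ-≤ D (ℚₚ.≤-trans (ℚₚ.0≤∣p∣ (a M)) (ℚₚ.<⇒≤ (f M ℕₚ.≤-refl)))))

  bound-pos : ∀ a B N → Bounds a B N → 0ℚ ℚ.< B
  bound-pos a B N f = ℚₚ.≤-<-trans (ℚₚ.0≤∣p∣ (a N)) (f N ℕₚ.≤-refl)

  common-bound : ∀ {a d} → Cauchy a → Cauchy d →
    ∃ λ B → 0ℚ ℚ.< B × ∃ λ N → Bounds a B N × Bounds d B N
  common-bound {a} {d} ca cd =
    let A , M , f = bound {a} ca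
        D , N , g = bound {d} cd
        f′ = bound-+ˡ {a} {d} {A} {D} {M} {N} f g
    in A ℚ.+ D , bound-pos a (A ℚ.+ D) (M ⊔ N) f′ , M ⊔ N , f′ , bound-+ʳ {a} {d} {A} {D} {M} {N} f g

  shrink : ∀ B → .{{_ : Positive B}} → ∀ {ε} → 0ℚ ℚ.< ε → ∃ λ δ → 0ℚ ℚ.< δ × B ℚ.* δ ≡ ½ ℚ.* ε
  shrink B {ε} 0<ε = δ , ℚₚ.positive⁻¹ δ {{ℚₚ.pos*pos⇒pos (½ ℚ.* ε) {{positive (half-pos 0<ε)}} (1/B) {{ℚₚ.1/pos⇒pos B}}}} , eq
    where
    1/B = (ℚ.1/ B) {{ℚₚ.pos⇒nonZero B}}
    δ = ½ ℚ.* ε ℚ.* 1/B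
    eq : B ℚ.* δ ≡ ½ ℚ.* ε
    eq = trans (solve 3 (λ b e i → b :* (e :* i) := e :* (b :* i)) refl B (½ ℚ.* ε) 1/B)
      (trans (cong (½ ℚ.* ε ℚ.*_) (ℚₚ.*-inverseʳ B {{ℚₚ.pos⇒nonZero B}})) (ℚₚ.*-identityʳ (½ ℚ.* ε)))

  abstract
    const-cauchy : ∀ q → Cauchy (λ _ → q)
    const-cauchy q ε 0<ε = 0 , λ _ _ _ _ → subst (ℚ._< ε) (sym (dist-self q)) 0<ε

    +-cauchy : ∀ {a b} → Cauchy a → Cauchy b → Cauchy (λ n → a n ℚ.+ b n)
    +-cauchy {a} {b} ca cb ε 0<ε =
      let M , f = ca (½ ℚ.* ε) (half-pos 0<ε)
          N , g = cb (½ ℚ.* ε) (half-pos 0<ε)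
      in M ⊔ N , λ m n lm ln → add-close ε (a m) (b m) (a n) (b n)
        (f m n (⊔ˡ-≤ lm) (⊔ˡ-≤ ln)) (g m n (⊔ʳ-≤ lm) (⊔ʳ-≤ ln))

    neg-cauchy : ∀ {a} → Cauchy a → Cauchy (λ n → ℚ.- a n)
    neg-cauchy {a} ca ε 0<ε =
      let N , f = ca ε 0<ε
      in N , λ m n lm ln → neg-close ε (a m) (a n) (f m n lm ln)

    *-cauchy : ∀ {a b} → Cauchy a → Cauchy b → Cauchy (λ n → a n ℚ.* b n)
    *-cauchy {a} {b} ca cb ε 0<ε =
      let B , 0<B , L , aB , bB = common-bound {a} {b} ca cb
          δ , 0<δ , eq = shrink B {{positive 0<B}} 0<ε
          M , f = ca δ 0<δ
          N , g = cb δ 0<δ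
      in L ⊔ (M ⊔ N) , λ m n lm ln →
        mul-close ε B δ {{positive 0<B}} eq (a m) (b m) (a n) (b n)
          (aB m (⊔ˡ-≤ lm)) (bB n (⊔ˡ-≤ ln))
          (f m n (⊔ˡ-≤ (⊔ʳ-≤ {L} lm)) (⊔ˡ-≤ (⊔ʳ-≤ {L} ln)))
          (g m n (⊔ʳ-≤ {M} (⊔ʳ-≤ {L} lm)) (⊔ʳ-≤ {M} (⊔ʳ-≤ {L} ln)))

infixl 6 _+ᴿ_
infixl 7 _*ᴿ_
infix  8 -ᴿ_

_+ᴿ_ _*ᴿ_ : ℝ → ℝ → ℝ
x +ᴿ y = mkℝ (λ n → seq x n ℚ.+ seq y n) (+-cauchy {seq x} {seq y} (cauchy x) (cauchy y))
x *ᴿ y = mkℝ (λ n → seq x n ℚ.* seq y n) (*-cauchy {seq x} {seq y} (cauchy x) (cauchy y))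

-ᴿ_ : ℝ → ℝ
-ᴿ x = mkℝ (λ n → ℚ.- seq x n) (neg-cauchy {seq x} (cauchy x))

fromℚᴿ : ℚ → ℝ
fromℚᴿ q = mkℝ (λ _ → q) (const-cauchy q)

+ᴿ-cong : ∀ {x y u v} → x ≈ᴿ y → u ≈ᴿ v → x +ᴿ u ≈ᴿ y +ᴿ v
+ᴿ-cong {x} {y} {u} {v} (mk≈ᴿ x≈y) (mk≈ᴿ u≈v) = mk≈ᴿ λ ε 0<ε →
  let M , f = x≈y (½ ℚ.* ε) (half-pos 0<ε)
      N , g = u≈v (½ ℚ.* ε) (half-pos 0<ε)
  in M ⊔ N , λ n le →
    add-close ε (seq x n) (seq u n) (seq y n) (seq v n) (f n (⊔ˡ-≤ le)) (g n (⊔ʳ-≤ le))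

-ᴿ-cong : ∀ {x y} → x ≈ᴿ y → -ᴿ x ≈ᴿ -ᴿ y
-ᴿ-cong {x} {y} (mk≈ᴿ x≈y) = mk≈ᴿ λ ε 0<ε →
  let N , f = x≈y ε 0<ε
  in N , λ n le → neg-close ε (seq x n) (seq y n) (f n le)

*ᴿ-cong : ∀ {x y u v} → x ≈ᴿ y → u ≈ᴿ v → x *ᴿ u ≈ᴿ y *ᴿ v
*ᴿ-cong {x} {y} {u} {v} (mk≈ᴿ x≈y) (mk≈ᴿ u≈v) = mk≈ᴿ λ ε 0<ε →
  let B , 0<B , L , xB , vB = common-bound {seq x} {seq v} (cauchy x) (cauchy v)
      δ , 0<δ , eq = shrink B {{positive 0<B}} 0<ε
      M , f = x≈y δ 0<δ
      N , g = u≈v δ 0<δ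
  in L ⊔ (M ⊔ N) , λ n le →
    mul-close ε B δ {{positive 0<B}} eq (seq x n) (seq u n) (seq y n) (seq v n)
      (xB n (⊔ˡ-≤ le)) (vB n (⊔ˡ-≤ le))
      (f n (⊔ˡ-≤ (⊔ʳ-≤ {L} le))) (g n (⊔ʳ-≤ {M} (⊔ʳ-≤ {L} le)))

infix 5 _+i_
record ℂ : Set where
  constructor _+i_
  field
    re im : ℝ

open ℂ public

infix 4 _≈ᶜ_
record _≈ᶜ_ (z w : ℂ) : Set where
  constructor mk≈ᶜ
  field
    re≈ : re z ≈ᴿ re w
    im≈ : im z ≈ᴿ im w

open _≈ᶜ_ public

infixl 6 _+ᶜ_
infixl 7 _*ᶜ_
infix  8 -ᶜ_

_+ᶜ_ _*ᶜ_ : ℂ → ℂ → ℂ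
z +ᶜ w = (re z +ᴿ re w) +i (im z +ᴿ im w)
z *ᶜ w = (re z *ᴿ re w +ᴿ -ᴿ (im z *ᴿ im w)) +i (re z *ᴿ im w +ᴿ im z *ᴿ re w)

-ᶜ_ : ℂ → ℂ
-ᶜ z = (-ᴿ re z) +i (-ᴿ im z)

fromℚ : ℚ → ℂ
fromℚ q = fromℚᴿ q +i fromℚᴿ 0ℚ

fromℕ : ℕ → ℂ
fromℕ n = fromℚ (+ n ℚ./ 1)

private

  module ≈ᴿ = IsEquivalence ≈ᴿ-isEquivalence

  ≗⇒≈ᶜ : ∀ {z w} → (∀ n → seq (re z) n ≡ seq (re w) n) →
         (∀ n → seq (im z) n ≡ seq (im w) n) → z ≈ᶜ w
  ≗⇒≈ᶜ p q = mk≈ᶜ (mk≈ᴿ (≗⇒~ p)) (mk≈ᴿ (≗⇒~ q))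

  ≈ᶜ-isEquivalence : IsEquivalence _≈ᶜ_
  ≈ᶜ-isEquivalence = record
    { refl  = mk≈ᶜ ≈ᴿ.refl ≈ᴿ.refl
    ; sym   = λ (mk≈ᶜ p q) → mk≈ᶜ (≈ᴿ.sym p) (≈ᴿ.sym q)
    ; trans = λ (mk≈ᶜ p q) (mk≈ᶜ p′ q′) → mk≈ᶜ (≈ᴿ.trans p p′) (≈ᴿ.trans q q′)
    }

  +ᶜ-cong : ∀ {z w u v} → z ≈ᶜ w → u ≈ᶜ v → z +ᶜ u ≈ᶜ w +ᶜ v
  +ᶜ-cong (mk≈ᶜ p q) (mk≈ᶜ p′ q′) = mk≈ᶜ (+ᴿ-cong p p′) (+ᴿ-cong q q′)

  *ᶜ-cong : ∀ {z w u v} → z ≈ᶜ w → u ≈ᶜ v → z *ᶜ u ≈ᶜ w *ᶜ v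
  *ᶜ-cong (mk≈ᶜ p q) (mk≈ᶜ r s) = mk≈ᶜ
    (+ᴿ-cong (*ᴿ-cong p r) (-ᴿ-cong (*ᴿ-cong q s)))
    (+ᴿ-cong (*ᴿ-cong p s) (*ᴿ-cong q r))

ℂ-commutativeRing : CommutativeRing 0ℓ 0ℓ
ℂ-commutativeRing = record
  { Carrier = ℂ
  ; _≈_ = _≈ᶜ_
  ; _+_ = _+ᶜ_
  ; _*_ = _*ᶜ_
  ; -_  = -ᶜ_
  ; 0#  = fromℚ 0ℚ
  ; 1#  = fromℚ 1ℚ
  ; isCommutativeRing = record
    { isRing = record
      { +-isAbelianGroup = record
        { isGroup = record
          { isMonoid = record
            { isSemigroup = record
              { isMagma = record
                { isEquivalence = ≈ᶜ-isEquivalence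
                ; ∙-cong = +ᶜ-cong
                }
              ; assoc = λ (a +i b) (c +i d) (e +i f) → ≗⇒≈ᶜ
                  (λ n → ℚₚ.+-assoc (seq a n) (seq c n) (seq e n))
                  (λ n → ℚₚ.+-assoc (seq b n) (seq d n) (seq f n))
              }
            ; identity =
                (λ (a +i b) → ≗⇒≈ᶜ (λ n → ℚₚ.+-identityˡ (seq a n)) (λ n → ℚₚ.+-identityˡ (seq b n))) ,
                (λ (a +i b) → ≗⇒≈ᶜ (λ n → ℚₚ.+-identityʳ (seq a n)) (λ n → ℚₚ.+-identityʳ (seq b n)))
            }
          ; inverse =
              (λ (a +i b) → ≗⇒≈ᶜ (λ n → ℚₚ.+-inverseˡ (seq a n)) (λ n → ℚₚ.+-inverseˡ (seq b n))) ,
              (λ (a +i b) → ≗⇒≈ᶜ (λ n → ℚₚ.+-inverseʳ (seq a n)) (λ n → ℚₚ.+-inverseʳ (seq b n)))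
          ; ⁻¹-cong = λ (mk≈ᶜ p q) → mk≈ᶜ (-ᴿ-cong p) (-ᴿ-cong q)
          }
        ; comm = λ (a +i b) (c +i d) → ≗⇒≈ᶜ
            (λ n → ℚₚ.+-comm (seq a n) (seq c n)) (λ n → ℚₚ.+-comm (seq b n) (seq d n))
        }
      ; *-cong = *ᶜ-cong
      ; *-assoc = λ (a +i b) (c +i d) (e +i f) → ≗⇒≈ᶜ
          (λ n → solve 6 (λ a b c d e f →
              (a :* c :- b :* d) :* e :- (a :* d :+ b :* c) :* f :=
              a :* (c :* e :- d :* f) :- b :* (c :* f :+ d :* e)) refl
            (seq a n) (seq b n) (seq c n) (seq d n) (seq e n) (seq f n))
          (λ n → solve 6 (λ a b c d e f →
              (a :* c :- b :* d) :* f :+ (a :* d :+ b :* c) :* e :=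
              a :* (c :* f :+ d :* e) :+ b :* (c :* e :- d :* f)) refl
            (seq a n) (seq b n) (seq c n) (seq d n) (seq e n) (seq f n))
      ; *-identity =
          (λ (a +i b) → ≗⇒≈ᶜ
            (λ n → solve 2 (λ a b → con 1ℚ :* a :- con 0ℚ :* b := a) refl (seq a n) (seq b n))
            (λ n → solve 2 (λ a b → con 1ℚ :* b :+ con 0ℚ :* a := b) refl (seq a n) (seq b n))) ,
          (λ (a +i b) → ≗⇒≈ᶜ
            (λ n → solve 2 (λ a b → a :* con 1ℚ :- b :* con 0ℚ := a) refl (seq a n) (seq b n))
            (λ n → solve 2 (λ a b → a :* con 0ℚ :+ b :* con 1ℚ := b) refl (seq a n) (seq b n)))
      ; distrib =
          (λ (a +i b) (c +i d) (e +i f) → ≗⇒≈ᶜ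
            (λ n → solve 6 (λ a b c d e f →
                a :* (c :+ e) :- b :* (d :+ f) := (a :* c :- b :* d) :+ (a :* e :- b :* f)) refl
              (seq a n) (seq b n) (seq c n) (seq d n) (seq e n) (seq f n))
            (λ n → solve 6 (λ a b c d e f →
                a :* (d :+ f) :+ b :* (c :+ e) := (a :* d :+ b :* c) :+ (a :* f :+ b :* e)) refl
              (seq a n) (seq b n) (seq c n) (seq d n) (seq e n) (seq f n))) ,
          (λ (a +i b) (c +i d) (e +i f) → ≗⇒≈ᶜ
            (λ n → solve 6 (λ a b c d e f →
                (c :+ e) :* a :- (d :+ f) :* b := (c :* a :- d :* b) :+ (e :* a :- f :* b)) refl
              (seq a n) (seq b n) (seq c n) (seq d n) (seq e n) (seq f n))
            (λ n → solve 6 (λ a b c d e f →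
                (c :+ e) :* b :+ (d :+ f) :* a := (c :* b :+ d :* a) :+ (e :* b :+ f :* a)) refl
              (seq a n) (seq b n) (seq c n) (seq d n) (seq e n) (seq f n)))
      }
    ; *-comm = λ (a +i b) (c +i d) → ≗⇒≈ᶜ
        (λ n → solve 4 (λ a b c d → a :* c :- b :* d := c :* a :- d :* b) refl
          (seq a n) (seq b n) (seq c n) (seq d n))
        (λ n → solve 4 (λ a b c d → a :* d :+ b :* c := c :* b :+ d :* a) refl
          (seq a n) (seq b n) (seq c n) (seq d n))
    }
  }

open RawSemiring (Semiring.rawSemiring (CommutativeRing.semiring ℂ-commutativeRing)) public
  using () renaming (sum to ∑; product to ∏; _^_ to _^ᶜ_)

-- ℂ* is the group of units of ℂ.  An element carries its inverse, which is
-- unique and so is ignored by the equality of the group.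

module _ (R : CommutativeRing c ℓ) where

  open CommutativeRing R hiding (refl; sym; trans)
  private module ≈ = CommutativeRing R using (refl; sym; trans)

  record Unit : Set (c ⊔ˡ ℓ) where
    constructor mkUnit
    field
      value     : Carrier
      inverse   : Carrier
      isInverse : value * inverse ≈ 1#

  open Unit

  private
    open import Relation.Binary.Reasoning.Setoid setoid

    *-unit : Unit → Unit → Unit
    *-unit (mkUnit x x⁻¹ p) (mkUnit y y⁻¹ q) = mkUnit (x * y) (y⁻¹ * x⁻¹) (begin
      (x * y) * (y⁻¹ * x⁻¹)  ≈⟨ *-assoc x y (y⁻¹ * x⁻¹) ⟩
      x * (y * (y⁻¹ * x⁻¹))  ≈⟨ *-congˡ (≈.sym (*-assoc y y⁻¹ x⁻¹)) ⟩
      x * ((y * y⁻¹) * x⁻¹)  ≈⟨ *-congˡ (*-congʳ q) ⟩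
      x * (1# * x⁻¹)         ≈⟨ *-congˡ (*-identityˡ x⁻¹) ⟩
      x * x⁻¹                ≈⟨ p ⟩
      1#                     ∎)

    inverse-cong : ∀ u v → value u ≈ value v → inverse u ≈ inverse v
    inverse-cong (mkUnit x x⁻¹ p) (mkUnit y y⁻¹ q) x≈y = begin
      x⁻¹                ≈⟨ ≈.sym (*-identityʳ x⁻¹) ⟩
      x⁻¹ * 1#           ≈⟨ *-congˡ (≈.sym q) ⟩
      x⁻¹ * (y * y⁻¹)    ≈⟨ *-congˡ (*-congʳ (≈.sym x≈y)) ⟩
      x⁻¹ * (x * y⁻¹)    ≈⟨ ≈.sym (*-assoc x⁻¹ x y⁻¹) ⟩
      (x⁻¹ * x) * y⁻¹    ≈⟨ *-congʳ (≈.trans (*-comm x⁻¹ x) p) ⟩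
      1# * y⁻¹           ≈⟨ *-identityˡ y⁻¹ ⟩
      y⁻¹                ∎

  unitGroup : AbelianGroup (c ⊔ˡ ℓ) ℓ
  unitGroup = record
    { Carrier = Unit
    ; _≈_ = λ u v → value u ≈ value v
    ; _∙_ = *-unit
    ; ε   = mkUnit 1# 1# (*-identityˡ 1#)
    ; _⁻¹ = λ (mkUnit x x⁻¹ p) → mkUnit x⁻¹ x (≈.trans (*-comm x⁻¹ x) p)
    ; isAbelianGroup = record
      { isGroup = record
        { isMonoid = record
          { isSemigroup = record
            { isMagma = record
              { isEquivalence = record { refl = ≈.refl ; sym = ≈.sym ; trans = ≈.trans }
              ; ∙-cong = *-cong
              }
            ; assoc = λ u v w → *-assoc (value u) (value v) (value w)
            }
          ; identity = (λ u → *-identityˡ (value u)) , (λ u → *-identityʳ (value u))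
          }
        ; inverse = (λ u → ≈.trans (*-comm (inverse u) (value u)) (isInverse u)) , isInverse
        ; ⁻¹-cong = λ {u} {v} → inverse-cong u v
        }
      ; comm = λ u v → *-comm (value u) (value v)
      }
    }

ℂ* : AbelianGroup 0ℓ 0ℓ
ℂ* = unitGroup ℂ-commutativeRing

HasCardinality : Setoid c ℓ → ℕ → Set (c ⊔ˡ ℓ)
HasCardinality S n = Inverse S (≡.setoid (Fin n))

Finite : Setoid c ℓ → Set (c ⊔ˡ ℓ)
Finite S = ∃ (HasCardinality S)

-- The value does not depend on the enumeration when f respects the equality of S.

sumOver : {S : Setoid c ℓ} → Finite S → (Setoid.Carrier S → ℂ) → ℂ
sumOver (_ , enum) f = ∑ (f ∘ Inverse.from enum)

Character : AbelianGroup c ℓ → Set (c ⊔ˡ ℓ)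
Character G = GroupHomomorphism (AbelianGroup.rawGroup G) (AbelianGroup.rawGroup ℂ*)

infixl 20 _⟨_⟩
_⟨_⟩ : {G : RawGroup c ℓ} → GroupHomomorphism G (AbelianGroup.rawGroup ℂ*) → RawGroup.Carrier G → ℂ
χ ⟨ x ⟩ = Unit.value (GroupHomomorphism.⟦_⟧ χ x)

-- Only the underlying setoid of the dual group is needed, not its multiplication.
Dual : AbelianGroup c ℓ → Setoid (c ⊔ˡ ℓ) c
Dual G = record
  { Carrier = Character G
  ; _≈_ = λ χ ψ → ∀ x → χ ⟨ x ⟩ ≈ᶜ ψ ⟨ x ⟩
  ; isEquivalence = record
    { refl  = λ x → ≈.refl
    ; sym   = λ p x → ≈.sym (p x)
    ; trans = λ p q x → ≈.trans (p x) (q x)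
    }
  }
  where module ≈ = CommutativeRing ℂ-commutativeRing using (refl; sym; trans)

-- All tuples f with 0 ≤ f i ≤ e i, each listed once.

exponents : ∀ {g} → Vector ℕ g → List (Vector ℕ g)
exponents {zero}  _ = [ Vector.[] ]
exponents {suc g} e =
  cartesianProductWith Vector._∷_ (upTo (suc (Vector.head e))) (exponents (Vector.tail e))

module _ (G : AbelianGroup c ℓ) {h : ℕ} (∣G∣≡h : HasCardinality (AbelianGroup.setoid G) h) where

  open AbelianGroup G
  open RawMonoid rawMonoid using (sum) renaming (_×_ to _·_)

  _≈?_ : Decidable _≈_
  _≈?_ = via-injection (Inverse⇒Injection ∣G∣≡h) _≟ᶠ_

  weightedSum : ∀ {g} → Vector Carrier g → Vector ℕ g → Carrier
  weightedSum r f = sum (λ i → f i · r i)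

  zeroSumCount : ∀ {g} → Vector Carrier g → Vector ℕ g → ℕ
  zeroSumCount r e = length (filter (λ f → weightedSum r f ≈? ε) (exponents e))

  order-nonZero : ℕ.NonZero h
  order-nonZero = nonZeroIndex (Inverse.to ∣G∣≡h ε)

  1/order : ℂ
  1/order = fromℚ ((+ 1 ℚ./ h) {{order-nonZero}})

module Submission where

-- Count with the indicator δ of 0, using Σ_χ χ(x) = h δ(x), and expand the
-- product of sums into a sum over the tuples of exponents.
--
-- This orthogonality relation is Fourier inversion for δ.  Inversion is linear
-- and holds for characters by the other orthogonality relation.  Since the
-- translation by x has order dividing h, every function is a sum of
-- eigenfunctions of that translation; applying this to one x after the other
-- leaves joint eigenfunctions of all translations, which are multiples of
-- characters.
--
-- Constructively, everything rests on a primitive h-th root of unity ζ in ℂ.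
-- It comes from the largest zero x = 2 cos (π / 2h) of a Chebyshev polynomial,
-- found by bisection over ℚ; then x / 2 and sin (π / 2h) are rational functions
-- of x, so no square root has to be taken.  As ℂ is a local ring, z^h = 1 gives
-- an index j with z = ζ^j, which makes the dual group finite.

open import Defs
open import Algebra.Bundles using (AbelianGroup; CommutativeMonoid; CommutativeRing; Semiring)
import Algebra.Definitions.RawSemiring as RawSemiring
open import Algebra.Morphism.Bundles using (GroupHomomorphism)
import Algebra.Properties.AbelianGroup as AbelianGroupProperties
import Algebra.Properties.CommutativeMonoid.Mult as CommutativeMonoidMult
import Algebra.Properties.CommutativeMonoid.Sum as CommutativeMonoidSum
import Algebra.Properties.CommutativeSemigroup as CommutativeSemigroupProperties
import Algebra.Properties.CommutativeSemiring.Exp as Exp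
import Algebra.Properties.Group as GroupProperties
import Algebra.Properties.Semiring.Mult as Mult
import Algebra.Properties.Semiring.Sum as Sum
import Algebra.Solver.Ring.NaturalCoefficients.Default as SemiringSolver
open import Data.Empty using (⊥-elim)
open import Data.Fin.Base as Fin using (Fin; toℕ; inject₁; fromℕ<; finToFun; funToFin)
open import Data.Fin.Permutation using (Permutation′; permutation)
import Data.Fin.Properties as Finₚ
open import Data.Integer.Base as ℤ using (+_; +[1+_])
import Data.Integer.Properties as ℤₚ
open import Data.List.Base
  using (List; []; _∷_; _++_; allFin; applyUpTo; cartesianProductWith; concatMap;
         deduplicate; filter; length; lookup; map; upTo)
open import Data.List.Membership.Propositional using (_∈_)
open import Data.List.Membership.Propositional.Properties using (∈-allFin; ∈-lookup)
open import Data.List.Properties using (filter-accept; filter-reject)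
open import Data.List.Relation.Unary.All as All using ()
open import Data.List.Relation.Unary.AllPairs using ([]; _∷_)
open import Data.List.Relation.Unary.Any as Any using (Any; here; there)
import Data.List.Relation.Unary.Any.Properties as Anyₚ
import Data.List.Relation.Unary.Enumerates.Setoid as Enumerates
import Data.List.Relation.Unary.Enumerates.Setoid.Properties as Enumeratesₚ
import Data.List.Relation.Unary.Unique.DecSetoid.Properties as Uniqueₚ
import Data.List.Relation.Unary.Unique.Setoid as Unique
open import Data.Nat.Base as ℕ using (ℕ; zero; suc; z≤n; s≤s; _∸_)
open import Data.Nat.Coprimality using (1-coprimeTo) renaming (sym to coprime-sym)
import Data.Nat.Properties as ℕₚ
open import Data.Product.Base using (∃; ∃₂; Σ; _×_; _,_; proj₁; proj₂)
open import Data.Rational.Base as ℚ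
  using (ℚ; mkℚ; 0ℚ; 1ℚ; ½; ∣_∣; positive; nonNegative; *<*; toℚᵘ)
import Data.Rational.Properties as ℚₚ
open import Data.Rational.Solver using (module +-*-Solver)
import Data.Rational.Unnormalised.Base as ℚᵘ
import Data.Rational.Unnormalised.Properties as ℚᵘₚ
open import Data.Sum.Base as ⊎ using (_⊎_; inj₁; inj₂)
open import Data.Vec.Functional as Vector using (Vector; removeAt; replicate)
open import Function.Base using (_∘_)
open import Function.Bundles using (Inverse)
import Function.Construct.Composition as Composition
import Function.Construct.Symmetry as Symmetry
open import Level using (Level; 0ℓ; _⊔_)
open import Relation.Binary.Bundles using (DecSetoid; Setoid)
open import Relation.Binary.PropositionalEquality as ≡ using (_≡_; _≢_)
import Relation.Binary.Reasoning.Setoid as SetoidReasoning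
open import Relation.Binary.Structures using (IsEquivalence)
open import Relation.Nullary using (¬_; Dec; yes; no)
open import Relation.Nullary.Decidable using (from-yes)
open import Relation.Unary using (Decidable; Pred)

-- Orthogonality needs enough characters to tell x from 0. The usual sources, the structure theorem
-- or the extension of characters from subgroups, are replaced by linear algebra: the characters
-- arise as systems of eigenvalues of the translations. Splitting a function into eigenfunctions
-- takes all h-th roots of unity and division by h, so ζ is the one analytic ingredient. Equality in
-- ℂ is not decidable, and this shapes the rest. Case distinctions are made only between h-th roots
-- of unity, which have indices, and their negative branch must allow cancellation; ζ^j ≠ 1 is too
-- weak for that, and `Apart` takes its place. Likewise u j = sin jθ / sin θ, with θ = π / 2h, must
-- be bounded away from 0 for 0 < j < 2h, not merely nonzero; Sturm comparison with a rational point
-- supplies the bound. The angle is a quarter of 2π / h because then sin hθ = 1, which makes sin θ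
-- the inverse of u h.

private
  variable
    a b c ℓ p q s : Level

-- Takes the place of a decision procedure for a universal statement. In use P is an equation in the
-- ring and Q an apartness, which carries more than the negation of P.
∀⊎∃ : ∀ {n} {P : Fin n → Set p} {Q : Fin n → Set q} →
      (∀ i → P i ⊎ Q i) → (∀ i → P i) ⊎ ∃ Q
∀⊎∃ {n = zero} f = inj₁ λ ()
∀⊎∃ {n = suc n} f with f Fin.zero | ∀⊎∃ (f ∘ Fin.suc)
... | inj₂ q | _            = inj₂ (Fin.zero , q)
... | inj₁ p | inj₂ (i , q) = inj₂ (Fin.suc i , q)
... | inj₁ p | inj₁ ps      = inj₁ λ { Fin.zero → p ; (Fin.suc i) → ps i }

-- Finite sums in a commutative monoid

module _ (M : CommutativeMonoid a b) where

  open CommutativeMonoid M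
  open CommutativeMonoidSum M
  open SetoidReasoning setoid

  sum-only : ∀ {n} {f : Vector Carrier n} i → (∀ j → j ≢ i → f j ≈ ε) → sum f ≈ f i
  sum-only {suc n} {f} i f≈ε = begin
    sum f                       ≈⟨ sum-remove {i = i} f ⟩
    f i ∙ sum (removeAt f i)    ≈⟨ ∙-congˡ (sum-cong-≋ λ j → f≈ε _ (Finₚ.punchInᵢ≢i i j)) ⟩
    f i ∙ sum (replicate n ε)   ≈⟨ ∙-congˡ (sum-replicate-zero n) ⟩
    f i ∙ ε                     ≈⟨ identityʳ (f i) ⟩
    f i                         ∎

  -- The two sums differ only in F n against F 0. With F a sequence of powers, this is why a
  -- geometric sum of a root of unity is fixed by multiplication by its ratio.
  sum-shift : ∀ n (F : ℕ → Carrier) → F n ≈ F 0 →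
              sum {n} (F ∘ suc ∘ toℕ) ≈ sum {n} (F ∘ toℕ)
  sum-shift zero    F _     = refl
  sum-shift (suc n) F Fn≈F0 = begin
    sum {suc n} (F ∘ suc ∘ toℕ)          ≈⟨ sum-init-last {n} (F ∘ suc ∘ toℕ) ⟩
    sum {n} (F ∘ suc ∘ toℕ ∘ inject₁) ∙ F (suc (toℕ (Fin.fromℕ n)))
      ≡⟨ ≡.cong₂ _∙_ (sum-cong-≗ {n} (≡.cong (F ∘ suc) ∘ Finₚ.toℕ-inject₁))
                     (≡.cong (F ∘ suc) (Finₚ.toℕ-fromℕ n)) ⟩
    sum {n} (F ∘ suc ∘ toℕ) ∙ F (suc n)  ≈⟨ comm _ _ ⟩
    F (suc n) ∙ sum {n} (F ∘ suc ∘ toℕ)  ≈⟨ ∙-congʳ Fn≈F0 ⟩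
    sum {suc n} (F ∘ toℕ)                ∎

-- Translations of a finite abelian group

module Translation (G : AbelianGroup c ℓ) {h : ℕ} (enum : HasCardinality (AbelianGroup.setoid G) h) where

  private module G = AbelianGroup G
  open G using (_∙_; ε; _⁻¹)
  open Inverse enum using () renaming (to to index; from to elem; to-cong to index-cong) public
  open AbelianGroupProperties G

  elem-index : ∀ x → elem (index x) G.≈ x
  elem-index = Inverse.strictlyInverseʳ enum

  index-elem : ∀ i → index (elem i) ≡ i
  index-elem = Inverse.strictlyInverseˡ enum

  translate : G.Carrier → Permutation′ h
  translate x = permutation (shift x) (shift (x ⁻¹))
    (λ i → cancel x (x ⁻¹) (G.inverseˡ x) i) (λ i → cancel (x ⁻¹) x (G.inverseʳ x) i)
    where
    shift : G.Carrier → Fin h → Fin h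
    shift x i = index (elem i ∙ x)
    cancel : ∀ x y → y ∙ x G.≈ ε → ∀ i → shift x (shift y i) ≡ i
    cancel x y yx≈ε i = ≡.trans (index-cong (begin
      elem (index (elem i ∙ y)) ∙ x  ≈⟨ G.∙-congʳ (elem-index _) ⟩
      elem i ∙ y ∙ x                 ≈⟨ G.assoc _ _ _ ⟩
      elem i ∙ (y ∙ x)               ≈⟨ G.∙-congˡ yx≈ε ⟩
      elem i ∙ ε                     ≈⟨ G.identityʳ _ ⟩
      elem i                         ∎)) (index-elem i)
      where open SetoidReasoning G.setoid

  module _ (M : CommutativeMonoid a b) where

    private module M = CommutativeMonoid M
    open CommutativeMonoidSum M

    sum-translate : (f : G.Carrier → M.Carrier) → (∀ {x y} → x G.≈ y → f x M.≈ f y) →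
                    ∀ x → sum (λ i → f (elem i ∙ x)) M.≈ sum (f ∘ elem)
    sum-translate f f-cong x = M.sym (M.trans (sum-permute (f ∘ elem) (translate x))
      (sum-cong-≋ λ i → f-cong (elem-index (elem i ∙ x))))

  open CommutativeMonoidMult G.commutativeMonoid using () renaming (_×_ to _·_)

  -- Lagrange's theorem without cosets: translating by x permutes the terms of the sum of all
  -- elements, yet adds h · x to it.
  order·x≈ε : ∀ x → h · x G.≈ ε
  order·x≈ε x = identityʳ-unique (sum elem) (h · x) (begin
    sum elem ∙ h · x                 ≈⟨ G.∙-congˡ (sum-replicate h) ⟨
    sum elem ∙ sum {h} (λ _ → x)     ≈⟨ ∑-distrib-+ elem (λ _ → x) ⟨
    sum (λ i → elem i ∙ x)           ≈⟨ sum-translate G.commutativeMonoid (λ x → x) (λ p → p) x ⟩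
    sum elem                         ∎)
    where
    open CommutativeMonoidSum G.commutativeMonoid
    open SetoidReasoning G.setoid

-- Roots of unity in a local ring

module _ (R : CommutativeRing a b) where

  open CommutativeRing R
  open Exp commutativeSemiring
  open Mult semiring using () renaming (_×_ to _·_)
  open Sum semiring
  open SetoidReasoning setoid
  open CommutativeSemigroupProperties *-commutativeSemigroup using (xy∙z≈y∙xz)

  -- A multiplicative way to say that z − w is regular.
  Apart : Carrier → Carrier → Set (a ⊔ b)
  Apart z w = ∀ t → z * t ≈ w * t → t ≈ 0#

  -- The interface between the ring and the Fourier part. `complete` can fail in a ring with
  -- nontrivial idempotents, and `separated` stands in for decidable equality.
  record RootsOfUnity (h : ℕ) : Set (a ⊔ b) where
    field
      root       : Fin h → Carrier
      root^h     : ∀ j → root j ^ h ≈ 1#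
      complete   : ∀ z → z ^ h ≈ 1# → ∃ λ j → z ≈ root j
      separated  : ∀ z w → z ^ h ≈ 1# → w ^ h ≈ 1# → z ≈ w ⊎ Apart z w
      sum-root   : ∀ i → 0 ℕ.< i → i ℕ.< h → sum (λ j → root j ^ i) ≈ 0#
      h⁻¹        : Carrier
      h*h⁻¹      : h · 1# * h⁻¹ ≈ 1#
      nontrivial : ¬ 1# ≈ 0#

  Invertible : Carrier → Set (a ⊔ b)
  Invertible z = ∃ λ v → z * v ≈ 1#

  invertible⇒regular : ∀ {z} → Invertible z → ∀ t → z * t ≈ 0# → t ≈ 0#
  invertible⇒regular {z} (v , zv≈1) t zt≈0 = begin
    t              ≈⟨ *-identityˡ t ⟨
    1# * t         ≈⟨ *-congʳ (trans (sym zv≈1) (*-comm z v)) ⟩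
    v * z * t      ≈⟨ *-assoc v z t ⟩
    v * (z * t)    ≈⟨ *-congˡ zt≈0 ⟩
    v * 0#         ≈⟨ zeroʳ v ⟩
    0#             ∎

  Local : Set (a ⊔ b)
  Local = ∀ z w → z + w ≈ 1# → Invertible z ⊎ Invertible w

  1^n≈1 : ∀ n → 1# ^ n ≈ 1#
  1^n≈1 zero    = refl
  1^n≈1 (suc n) = trans (*-identityˡ _) (1^n≈1 n)

  ^-comm : ∀ z m n → (z ^ m) ^ n ≈ (z ^ n) ^ m
  ^-comm z m n = trans (^-assocʳ z m n) (trans (^-congʳ z (ℕₚ.*-comm m n)) (sym (^-assocʳ z n m)))

  geometric-shift : ∀ h t → t ^ h ≈ 1# → t * sum {h} (λ i → t ^ toℕ i) ≈ sum {h} (λ i → t ^ toℕ i)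
  geometric-shift h t tʰ≈1 =
    trans (*-distribˡ-sum {h} t _) (sum-shift +-commutativeMonoid h (t ^_) tʰ≈1)

  module _ (nontrivial : ¬ 1# ≈ 0#) (local : Local) where

    -- Multiplying by v turns head plus tail into a decomposition of 1, to which `local` applies.
    -- This is how an index is found without testing any element for 0.
    sum-invertible : ∀ {n} (f : Vector Carrier n) v → sum f * v ≈ 1# → ∃ λ i → Invertible (f i)
    sum-invertible {zero}  f v eq = ⊥-elim (nontrivial (trans (sym eq) (zeroˡ v)))
    sum-invertible {suc n} f v eq
      with local (f Fin.zero * v) (sum (f ∘ Fin.suc) * v) (trans (sym (distribʳ _ _ _)) eq)
    ... | inj₁ (w , fvw≈1) = Fin.zero , v * w , trans (sym (*-assoc _ _ _)) fvw≈1
    ... | inj₂ (w , svw≈1) with sum-invertible (f ∘ Fin.suc) (v * w) (trans (sym (*-assoc _ _ _)) svw≈1)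
    ...   | i , inv = Fin.suc i , inv

    module _ {h : ℕ} (0<h : 0 ℕ.< h) {h⁻¹ ζ : Carrier} (h*h⁻¹ : h · 1# * h⁻¹ ≈ 1#) (ζʰ≈1 : ζ ^ h ≈ 1#)
             (ζ-apart : ∀ i → 0 ℕ.< i → i ℕ.< h → Apart (ζ ^ i) 1#) where

      private

        root : Fin h → Carrier
        root j = ζ ^ toℕ j

        ζ^n^h≈1 : ∀ n → (ζ ^ n) ^ h ≈ 1#
        ζ^n^h≈1 n = trans (^-comm ζ n h) (trans (^-congˡ n ζʰ≈1) (1^n≈1 n))

        -- The sum is geometric in ζ^i, hence fixed by ζ^i, which is apart from 1.
        sum-root : ∀ i → 0 ℕ.< i → i ℕ.< h → sum (λ j → root j ^ i) ≈ 0#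
        sum-root i 0<i i<h = begin
          sum {h} (λ j → (ζ ^ toℕ j) ^ i)  ≈⟨ sum-cong-≋ {h} (λ j → ^-comm ζ (toℕ j) i) ⟩
          S                                ≈⟨ ζ-apart i 0<i i<h S (trans
                                                (geometric-shift h (ζ ^ i) (ζ^n^h≈1 i)) (sym (*-identityˡ S))) ⟩
          0#                               ∎
          where
          S = sum {h} (λ j → (ζ ^ i) ^ toℕ j)

        zero-or-positive : ∀ n → n ≡ 0 ⊎ 0 ℕ.< n
        zero-or-positive zero    = inj₁ ≡.refl
        zero-or-positive (suc n) = inj₂ (s≤s z≤n)

        root-inverse : ∀ j → ∃ λ i → root j * root i ≈ 1#
        root-inverse j with zero-or-positive (toℕ j)
        ... | inj₁ j≡0 = j , trans (*-cong (^-congʳ ζ j≡0) (^-congʳ ζ j≡0)) (*-identityˡ 1#)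
        ... | inj₂ 0<j = fromℕ< h∸j<h , (begin
          ζ ^ toℕ j * ζ ^ toℕ (fromℕ< h∸j<h)  ≈⟨ *-congˡ (^-congʳ ζ (Finₚ.toℕ-fromℕ< h∸j<h)) ⟩
          ζ ^ toℕ j * ζ ^ (h ∸ toℕ j)         ≈⟨ ^-homo-* ζ (toℕ j) (h ∸ toℕ j) ⟨
          ζ ^ (toℕ j ℕ.+ (h ∸ toℕ j))         ≈⟨ ^-congʳ ζ (ℕₚ.m+[n∸m]≡n (ℕₚ.<⇒≤ (Finₚ.toℕ<n j))) ⟩
          ζ ^ h                               ≈⟨ ζʰ≈1 ⟩
          1#                                  ∎)
          where
          h∸j<h : h ∸ toℕ j ℕ.< h
          h∸j<h = ℕₚ.∸-monoʳ-< 0<j (ℕₚ.<⇒≤ (Finₚ.toℕ<n j))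

        module _ (z : Carrier) (zʰ≈1 : z ^ h ≈ 1#) where

          S : Fin h → Carrier
          S j = sum {h} (λ i → (z * root j) ^ toℕ i)

          -- After the sums are exchanged, the i-th term is z^i times the i-th power sum of the
          -- roots; only i = 0 survives, and contributes h.
          S-total : sum S ≈ h · 1#
          S-total = begin
            sum {h} (λ j → sum {h} (λ i → (z * root j) ^ toℕ i))
              ≈⟨ ∑-comm {h} {h} _ ⟩
            sum {h} (λ i → sum {h} (λ j → (z * root j) ^ toℕ i))
              ≈⟨ sum-cong-≋ {h} (λ i → trans (sum-cong-≋ {h} λ j → ^-distrib-* z (root j) (toℕ i))
                   (sym (*-distribˡ-sum {h} (z ^ toℕ i) (λ j → root j ^ toℕ i)))) ⟩
            sum {h} (λ i → T (toℕ i))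
              ≈⟨ sum-only +-commutativeMonoid {f = T ∘ toℕ {h}} (fromℕ< 0<h) T≈0 ⟩
            T (toℕ (fromℕ< 0<h))
              ≈⟨ reflexive (≡.cong T (Finₚ.toℕ-fromℕ< 0<h)) ⟩
            1# * sum {h} (λ j → 1#)
              ≈⟨ trans (*-identityˡ _) (sum-replicate h) ⟩
            h · 1# ∎
            where
            T : ℕ → Carrier
            T i = z ^ i * sum {h} (λ j → root j ^ i)
            T≈0 : ∀ i → i ≢ fromℕ< 0<h → T (toℕ i) ≈ 0#
            T≈0 i i≢0 with zero-or-positive (toℕ i)
            ... | inj₁ i≡0 = ⊥-elim (i≢0 (Finₚ.toℕ-injective (≡.trans i≡0 (≡.sym (Finₚ.toℕ-fromℕ< 0<h)))))
            ... | inj₂ 0<i = trans (*-congˡ (sum-root (toℕ i) 0<i (Finₚ.toℕ<n i))) (zeroʳ _)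

          S-invertible⇒inverse : ∀ j → Invertible (S j) → z * root j ≈ 1#
          S-invertible⇒inverse j (v , Sv≈1) = begin
            z * root j                ≈⟨ *-identityʳ _ ⟨
            z * root j * 1#           ≈⟨ *-congˡ Sv≈1 ⟨
            z * root j * (S j * v)    ≈⟨ *-assoc _ _ _ ⟨
            z * root j * S j * v      ≈⟨ *-congʳ (geometric-shift h (z * root j)
                                           (trans (^-distrib-* z (root j) h)
                                             (trans (*-cong zʰ≈1 (ζ^n^h≈1 (toℕ j))) (*-identityˡ 1#)))) ⟩
            S j * v                   ≈⟨ Sv≈1 ⟩
            1#                        ∎

          -- The geometric sums S of the z ζ^j add up to h, so one of them is invertible;
          -- it is also fixed by multiplication by z ζ^j, which must therefore be 1.
          complete : ∃ λ j → z ≈ root j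
          complete = i , (begin
            z                      ≈⟨ *-identityʳ z ⟨
            z * 1#                 ≈⟨ *-congˡ (proj₂ (root-inverse j)) ⟨
            z * (root j * root i)  ≈⟨ *-assoc _ _ _ ⟨
            z * root j * root i    ≈⟨ *-congʳ (S-invertible⇒inverse j (proj₂ invertible)) ⟩
            1# * root i            ≈⟨ *-identityˡ _ ⟩
            root i                 ∎)
            where
            invertible : ∃ λ j → Invertible (S j)
            invertible = sum-invertible S h⁻¹ (trans (*-congʳ S-total) h*h⁻¹)
            j i : Fin h
            j = proj₁ invertible
            i = proj₁ (root-inverse j)

        -- The quotient z w⁻¹ is again an h-th root of unity, so `complete` gives it an index, and
        -- whether an index is 0 is decidable. The inverse of w is itself found among the powers of
        -- ζ.
        separated : ∀ z w → z ^ h ≈ 1# → w ^ h ≈ 1# → z ≈ w ⊎ Apart z w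
        separated z w zʰ≈1 wʰ≈1 = decide (complete (z * w⁻¹) (begin
            (z * w⁻¹) ^ h    ≈⟨ ^-distrib-* z w⁻¹ h ⟩
            z ^ h * w⁻¹ ^ h  ≈⟨ *-cong zʰ≈1 (ζ^n^h≈1 (toℕ (proj₁ (root-inverse l)))) ⟩
            1# * 1#          ≈⟨ *-identityˡ 1# ⟩
            1#               ∎))
          where
          l : Fin h
          l = proj₁ (complete w wʰ≈1)
          w⁻¹ : Carrier
          w⁻¹ = root (proj₁ (root-inverse l))
          w⁻¹w≈1 : w⁻¹ * w ≈ 1#
          w⁻¹w≈1 = trans (*-comm _ _) (trans (*-congʳ (proj₂ (complete w wʰ≈1))) (proj₂ (root-inverse l)))
          decide : (∃ λ j → z * w⁻¹ ≈ root j) → z ≈ w ⊎ Apart z w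
          decide (j , zw⁻¹≈ζʲ) with zero-or-positive (toℕ j)
          ... | inj₁ j≡0 = inj₁ (begin
            z              ≈⟨ *-identityʳ z ⟨
            z * 1#         ≈⟨ *-congˡ w⁻¹w≈1 ⟨
            z * (w⁻¹ * w)  ≈⟨ *-assoc _ _ _ ⟨
            z * w⁻¹ * w    ≈⟨ *-congʳ (trans zw⁻¹≈ζʲ (^-congʳ ζ j≡0)) ⟩
            1# * w         ≈⟨ *-identityˡ w ⟩
            w              ∎)
          ... | inj₂ 0<j = inj₂ λ t zt≈wt → ζ-apart (toℕ j) 0<j (Finₚ.toℕ<n j) t (begin
            root j * t     ≈⟨ *-congʳ zw⁻¹≈ζʲ ⟨
            z * w⁻¹ * t    ≈⟨ xy∙z≈y∙xz _ _ _ ⟩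
            w⁻¹ * (z * t)  ≈⟨ *-congˡ zt≈wt ⟩
            w⁻¹ * (w * t)  ≈⟨ *-assoc _ _ _ ⟨
            w⁻¹ * w * t    ≈⟨ *-congʳ w⁻¹w≈1 ⟩
            1# * t         ∎)

      primitive⇒rootsOfUnity : RootsOfUnity h
      primitive⇒rootsOfUnity = record
        { root       = root
        ; root^h     = λ j → ζ^n^h≈1 (toℕ j)
        ; complete   = complete
        ; separated  = separated
        ; sum-root   = sum-root
        ; h⁻¹        = h⁻¹
        ; h*h⁻¹      = h*h⁻¹
        ; nontrivial = nontrivial
        }

  -- Powers of ω in terms of Chebyshev values

  -- With ω = e^{iθ} and ω̄ = e^{-iθ}, x is 2 cos θ, u j is sin jθ / sin θ and d is 2 i sin θ.
  module _ {ω ω̄ x d : Carrier} (u : ℕ → Carrier)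
           (ωω̄≈1 : ω * ω̄ ≈ 1#) (ω+ω̄≈x : ω + ω̄ ≈ x) (ω≈ω̄+d : ω ≈ ω̄ + d)
           (u₀ : u 0 ≈ 0#) (u₁ : u 1 ≈ 1#) (u-rec : ∀ j → u (2 ℕ.+ j) + u j ≈ x * u (suc j)) where

    private
      -- Both ω and ω̄ are roots of y² - x y + 1, whose recurrence is that of u.
      ^-rec : ∀ {y ȳ} → y * ȳ ≈ 1# → y + ȳ ≈ x → ∀ j → y ^ (2 ℕ.+ j) + y ^ j ≈ x * y ^ suc j
      ^-rec {y} {ȳ} yȳ≈1 y+ȳ≈x j = begin
        y * (y * y ^ j) + y ^ j              ≈⟨ +-congˡ (trans (*-congʳ (trans (*-comm ȳ y) yȳ≈1)) (*-identityˡ _)) ⟨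
        y * (y * y ^ j) + ȳ * y * y ^ j      ≈⟨ +-congˡ (*-assoc _ _ _) ⟩
        y * (y * y ^ j) + ȳ * (y * y ^ j)    ≈⟨ distribʳ _ _ _ ⟨
        (y + ȳ) * (y * y ^ j)                ≈⟨ *-congʳ y+ȳ≈x ⟩
        x * y ^ suc j                        ∎

    -- The formula 2 i sin jθ = (sin jθ / sin θ) · 2 i sin θ: both sides of ω^j - ω̄^j = u j · d
    -- obey the same recurrence with the same initial values.
    ω^j≈ω̄^j+ud : ∀ j → ω ^ j ≈ ω̄ ^ j + u j * d
    ω^j≈ω̄^j+ud zero = sym (trans (+-congˡ (trans (*-congʳ u₀) (zeroˡ d))) (+-identityʳ 1#))
    ω^j≈ω̄^j+ud (suc zero) = begin
      ω * 1#              ≈⟨ *-identityʳ ω ⟩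
      ω                   ≈⟨ ω≈ω̄+d ⟩
      ω̄ + d               ≈⟨ +-cong (*-identityʳ ω̄) (trans (*-congʳ u₁) (*-identityˡ d)) ⟨
      ω̄ * 1# + u 1 * d    ∎
    ω^j≈ω̄^j+ud (suc (suc j)) = ∙-cancelʳ (ω ^ j) _ _ (begin
      ω ^ (2 ℕ.+ j) + ω ^ j
        ≈⟨ ^-rec ωω̄≈1 ω+ω̄≈x j ⟩
      x * ω ^ suc j
        ≈⟨ *-congˡ (ω^j≈ω̄^j+ud (suc j)) ⟩
      x * (ω̄ ^ suc j + u (suc j) * d)
        ≈⟨ trans (distribˡ _ _ _) (+-congˡ (sym (*-assoc _ _ _))) ⟩
      x * ω̄ ^ suc j + x * u (suc j) * d
        ≈⟨ +-cong (^-rec (trans (*-comm ω̄ ω) ωω̄≈1) (trans (+-comm ω̄ ω) ω+ω̄≈x) j)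
             (trans (sym (distribʳ _ _ _)) (*-congʳ (u-rec j))) ⟨
      ω̄ ^ (2 ℕ.+ j) + ω̄ ^ j + (u (2 ℕ.+ j) * d + u j * d)
        ≈⟨ +-interchange _ _ _ _ ⟩
      ω̄ ^ (2 ℕ.+ j) + u (2 ℕ.+ j) * d + (ω̄ ^ j + u j * d)
        ≈⟨ +-congˡ (ω^j≈ω̄^j+ud j) ⟨
      ω̄ ^ (2 ℕ.+ j) + u (2 ℕ.+ j) * d + ω ^ j ∎)
      where
      open GroupProperties +-group using (∙-cancelʳ)
      open CommutativeSemigroupProperties +-commutativeSemigroup using () renaming (interchange to +-interchange)

    private
      ω^jω̄^j≈1 : ∀ j → ω ^ j * ω̄ ^ j ≈ 1#
      ω^jω̄^j≈1 j = trans (sym (^-distrib-* ω ω̄ j)) (trans (^-congˡ j ωω̄≈1) (1^n≈1 j))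

      ω²^j≈ω^j*ω^j : ∀ j → (ω ^ 2) ^ j ≈ ω ^ j * ω ^ j
      ω²^j≈ω^j*ω^j j = trans (^-congˡ j (*-congˡ (*-identityʳ ω))) (^-distrib-* ω ω j)

    u≈0⇒ω²^j≈1 : ∀ j → u j ≈ 0# → (ω ^ 2) ^ j ≈ 1#
    u≈0⇒ω²^j≈1 j uⱼ≈0 = begin
      (ω ^ 2) ^ j                      ≈⟨ ω²^j≈ω^j*ω^j j ⟩
      ω ^ j * ω ^ j                    ≈⟨ *-congˡ (ω^j≈ω̄^j+ud j) ⟩
      ω ^ j * (ω̄ ^ j + u j * d)        ≈⟨ *-congˡ (trans (+-congˡ (trans (*-congʳ uⱼ≈0) (zeroˡ d))) (+-identityʳ _)) ⟩
      ω ^ j * ω̄ ^ j                    ≈⟨ ω^jω̄^j≈1 j ⟩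
      1#                               ∎

    -- Behind this is the factorisation ω^(2j) - 1 = ω^j · u j · d into units.
    u-invertible⇒apart : ∀ j → Invertible d → Invertible (u j) → Apart ((ω ^ 2) ^ j) 1#
    u-invertible⇒apart j d-inv uⱼ-inv t eq = invertible⇒regular d-inv t (invertible⇒regular uⱼ-inv (d * t)
      (∙-cancelˡ (ω̄ ^ j * t) _ _ (begin
        ω̄ ^ j * t + u j * (d * t)              ≈⟨ +-congˡ (*-assoc _ _ _) ⟨
        ω̄ ^ j * t + u j * d * t                ≈⟨ distribʳ _ _ _ ⟨
        (ω̄ ^ j + u j * d) * t                  ≈⟨ *-congʳ (ω^j≈ω̄^j+ud j) ⟨
        ω ^ j * t                              ≈⟨ *-identityˡ _ ⟨
        1# * (ω ^ j * t)                       ≈⟨ *-congʳ (trans (sym (ω^jω̄^j≈1 j)) (*-comm _ _)) ⟩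
        ω̄ ^ j * ω ^ j * (ω ^ j * t)            ≈⟨ trans (*-assoc _ _ _) (*-congˡ (sym (*-assoc _ _ _))) ⟩
        ω̄ ^ j * (ω ^ j * ω ^ j * t)            ≈⟨ *-congˡ (*-congʳ (ω²^j≈ω^j*ω^j j)) ⟨
        ω̄ ^ j * ((ω ^ 2) ^ j * t)              ≈⟨ *-congˡ (trans eq (*-identityˡ t)) ⟩
        ω̄ ^ j * t                              ≈⟨ +-identityʳ _ ⟨
        ω̄ ^ j * t + 0#                         ∎)))
      where
      open GroupProperties +-group using (∙-cancelˡ)

  open SemiringSolver commutativeSemiring

  -- For x = 2 cos (π / 2h) and u j = sin (jπ / 2h) / sin (π / 2h), the inverse
  -- of u h is sin (π / 2h), and u (h + 1) divided by u h is cos (π / 2h).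
  primitive-root : ∀ {x i ī ½} (u : ℕ → Carrier) → u 0 ≈ 0# → u 1 ≈ 1# →
    (∀ j → u (2 ℕ.+ j) + u j ≈ x * u (suc j)) → i + ī ≈ 0# → i * ī ≈ 1# → ½ + ½ ≈ 1# →
    ∀ h′ (let h = suc h′) → u h * u h ≈ 1# + u (suc h) * u h′ → u h * u (suc h) ≈ u h * u h′ →
    u (2 ℕ.* h) ≈ 0# → (∀ j → 0 ℕ.< j → j ℕ.< 2 ℕ.* h → Invertible (u j)) →
    ∃ λ ζ → ζ ^ h ≈ 1# × (∀ j → 0 ℕ.< j → j ℕ.< h → Apart (ζ ^ j) 1#)
  primitive-root {x} {i} {ī} {½} u u₀ u₁ u-rec i+ī≈0 iī≈1 ½+½≈1 h′ cassini ba≈be u₂ₕ≈0 u-inv =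
    -- ω has angle π / 2h, so its fourth power has angle 2π / h. The two lemmas above speak of
    -- powers of ω², so ζ^j is governed by u at 2j.
    (ω ^ 2) ^ 2 ,
    trans (^-assocʳ (ω ^ 2) 2 (suc h′))
      (u≈0⇒ω²^j≈1 u ωω̄≈1 ω+ω̄≈x ω≈ω̄+d u₀ u₁ u-rec (2 ℕ.* suc h′) u₂ₕ≈0) ,
    λ j 0<j j<h t eq → u-invertible⇒apart u ωω̄≈1 ω+ω̄≈x ω≈ω̄+d u₀ u₁ u-rec (2 ℕ.* j) d-inv
      (u-inv (2 ℕ.* j) (ℕₚ.<-≤-trans 0<j (ℕₚ.m≤m+n j _)) (ℕₚ.*-monoʳ-< 2 j<h)) t
      (trans (*-congʳ (sym (^-assocʳ (ω ^ 2) 2 j))) eq)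
    where
    A B E r ω ω̄ d : Carrier
    A = u (2 ℕ.+ h′)
    B = u (suc h′)
    E = u h′
    B-inv : Invertible B
    B-inv = u-inv (suc h′) (s≤s z≤n) (ℕₚ.m<m+n (suc h′) (s≤s z≤n))
    r = proj₁ B-inv
    Br≈1 : B * r ≈ 1#
    Br≈1 = proj₂ B-inv
    ω = (A + i) * r
    ω̄ = (A + ī) * r
    d = (i + i) * r
    cancelB : ∀ {y z} → B * y ≈ B * z → y ≈ z
    cancelB {y} {z} By≈Bz = begin
      y             ≈⟨ trans (*-congʳ Br≈1) (*-identityˡ y) ⟨
      B * r * y     ≈⟨ solve 3 (λ b r y → b :* r :* y := r :* (b :* y)) refl B r y ⟩
      r * (B * y)   ≈⟨ *-congˡ By≈Bz ⟩
      r * (B * z)   ≈⟨ solve 3 (λ b r y → b :* r :* y := r :* (b :* y)) refl B r z ⟨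
      B * r * z     ≈⟨ trans (*-congʳ Br≈1) (*-identityˡ z) ⟩
      z             ∎
    -- Reflection in π / 2: sin (h + 1)θ = sin (h - 1)θ. With it Cassini's identity reads 1 + A² =
    -- B², which divided by B² is sin² θ + cos² θ = 1.
    A≈E : A ≈ E
    A≈E = cancelB ba≈be
    ωω̄≈1 : ω * ω̄ ≈ 1#
    ωω̄≈1 = begin
      (A + i) * r * ((A + ī) * r)
        ≈⟨ solve 4 (λ a i j r → (a :+ i) :* r :* ((a :+ j) :* r)
             := (i :* j :+ a :* a :+ a :* (i :+ j)) :* (r :* r)) refl A i ī r ⟩
      (i * ī + A * A + A * (i + ī)) * (r * r)
        ≈⟨ *-congʳ (+-cong (+-cong iī≈1 (*-congˡ A≈E)) (*-congˡ i+ī≈0)) ⟩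
      (1# + A * E + A * 0#) * (r * r)
        ≈⟨ *-congʳ (trans (+-congˡ (zeroʳ A)) (+-identityʳ _)) ⟩
      (1# + A * E) * (r * r)
        ≈⟨ *-congʳ cassini ⟨
      B * B * (r * r)
        ≈⟨ solve 2 (λ b r → b :* b :* (r :* r) := b :* r :* (b :* r)) refl B r ⟩
      B * r * (B * r)
        ≈⟨ trans (*-cong Br≈1 Br≈1) (*-identityˡ 1#) ⟩
      1# ∎
    ω+ω̄≈x : ω + ω̄ ≈ x
    ω+ω̄≈x = cancelB (begin
      B * ((A + i) * r + (A + ī) * r)
        ≈⟨ solve 5 (λ a i j r b → b :* ((a :+ i) :* r :+ (a :+ j) :* r)
             := b :* r :* (a :+ a :+ (i :+ j))) refl A i ī r B ⟩
      B * r * (A + A + (i + ī))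
        ≈⟨ *-cong Br≈1 (+-cong (+-congˡ A≈E) i+ī≈0) ⟩
      1# * (A + E + 0#)
        ≈⟨ trans (*-identityˡ _) (+-identityʳ _) ⟩
      A + E
        ≈⟨ u-rec h′ ⟩
      x * B
        ≈⟨ *-comm x B ⟩
      B * x ∎)
    ω≈ω̄+d : ω ≈ ω̄ + d
    ω≈ω̄+d = begin
      (A + i) * r
        ≈⟨ *-congʳ (trans (sym (+-identityʳ _)) (+-congˡ (sym i+ī≈0))) ⟩
      (A + i + (i + ī)) * r
        ≈⟨ solve 4 (λ a i j r → (a :+ i :+ (i :+ j)) :* r := (a :+ j) :* r :+ (i :+ i) :* r) refl A i ī r ⟩
      (A + ī) * r + (i + i) * r ∎
    d-inv : Invertible d
    d-inv = ī * ½ * B , (begin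
      (i + i) * r * (ī * ½ * B)
        ≈⟨ solve 5 (λ i j r b e → (i :+ i) :* r :* (j :* e :* b)
             := i :* j :* (e :+ e) :* (b :* r)) refl i ī r B ½ ⟩
      i * ī * (½ + ½) * (B * r)
        ≈⟨ *-cong (*-cong iī≈1 ½+½≈1) Br≈1 ⟩
      1# * 1# * 1#
        ≈⟨ trans (*-identityʳ _) (*-identityʳ _) ⟩
      1# ∎)

-- Finite setoids from enumerating lists

module _ (S : DecSetoid a b) where

  open DecSetoid S
  open Enumerates setoid using (IsEnumeration)
  open Unique setoid using (Unique)

  lookup-injective : ∀ {xs} → Unique xs → ∀ i j → lookup xs i ≈ lookup xs j → i ≡ j
  lookup-injective (x∉xs ∷ _)  Fin.zero    Fin.zero    _  = ≡.refl
  lookup-injective (x∉xs ∷ _)  Fin.zero    (Fin.suc j) eq = ⊥-elim (All.lookup x∉xs (∈-lookup j) eq)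
  lookup-injective (x∉xs ∷ _)  (Fin.suc i) Fin.zero    eq = ⊥-elim (All.lookup x∉xs (∈-lookup i) (sym eq))
  lookup-injective (_ ∷ uniq)  (Fin.suc i) (Fin.suc j) eq = ≡.cong Fin.suc (lookup-injective uniq i j eq)

  -- Once repetitions are removed, the position in the list is a bijective index.
  enumeration⇒finite : ∀ {xs} → IsEnumeration xs → Finite setoid
  enumeration⇒finite {xs} enumerates = length ys , record
    { to        = to
    ; from      = lookup ys
    ; to-cong   = λ {x} {y} x≈y → injective (trans (sym (lookup-to x)) (trans x≈y (lookup-to y)))
    ; from-cong = λ { ≡.refl → refl }
    ; inverse   = (λ {i} {x} x≈ → injective (trans (sym (lookup-to x)) x≈))
                , (λ { {x} ≡.refl → sym (lookup-to x) })
    }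
    where
    ys = deduplicate _≟_ xs
    enumerates′ : IsEnumeration ys
    enumerates′ = Enumeratesₚ.deduplicate⁺ S enumerates
    to : Carrier → Fin (length ys)
    to x = Any.index (enumerates′ x)
    lookup-to : ∀ x → x ≈ lookup ys (to x)
    lookup-to x = Anyₚ.lookup-index (enumerates′ x)
    injective : ∀ {i j} → lookup ys i ≈ lookup ys j → i ≡ j
    injective = lookup-injective (Uniqueₚ.deduplicate-! S xs) _ _

-- Sums over lists, for the list of exponent tuples

module ListSum (R : CommutativeRing a b) where

  open CommutativeRing R
  open Sum semiring
  open SetoidReasoning setoid

  listSum : ∀ {A : Set p} → (A → Carrier) → List A → Carrier
  listSum F []       = 0#
  listSum F (x ∷ xs) = F x + listSum F xs

  module _ {A : Set p} where

    listSum-cong : ∀ {F F′ : A → Carrier} → (∀ x → F x ≈ F′ x) → ∀ xs → listSum F xs ≈ listSum F′ xs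
    listSum-cong F≈F′ []       = refl
    listSum-cong F≈F′ (x ∷ xs) = +-cong (F≈F′ x) (listSum-cong F≈F′ xs)

    listSum-++ : ∀ (F : A → Carrier) xs ys → listSum F (xs ++ ys) ≈ listSum F xs + listSum F ys
    listSum-++ F []       ys = sym (+-identityˡ _)
    listSum-++ F (x ∷ xs) ys = trans (+-congˡ (listSum-++ F xs ys)) (sym (+-assoc _ _ _))

    listSum-* : ∀ r (F : A → Carrier) xs → r * listSum F xs ≈ listSum (λ x → r * F x) xs
    listSum-* r F []       = zeroʳ r
    listSum-* r F (x ∷ xs) = trans (distribˡ _ _ _) (+-congˡ (listSum-* r F xs))

    listSum-sum : ∀ {n} (F : Fin n → A → Carrier) xs →
                  listSum (λ x → sum (λ j → F j x)) xs ≈ sum (λ j → listSum (F j) xs)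
    listSum-sum {n} F []       = sym (sum-replicate-zero n)
    listSum-sum {n} F (x ∷ xs) = trans (+-congˡ (listSum-sum F xs))
                                   (sym (∑-distrib-+ (λ j → F j x) (λ j → listSum (F j) xs)))

  listSum-product : ∀ {A : Set p} {B : Set q} {C : Set s} (f : A → B → C)
                    {F : C → Carrier} {K : A → Carrier} {L : B → Carrier} →
                    (∀ x y → F (f x y) ≈ K x * L y) → ∀ xs ys →
                    listSum F (cartesianProductWith f xs ys) ≈ listSum K xs * listSum L ys
  listSum-product f F≈KL []       ys = sym (zeroˡ _)
  listSum-product f {F} {K} {L} F≈KL (x ∷ xs) ys = begin
    listSum F (map (f x) ys ++ cartesianProductWith f xs ys)
      ≈⟨ listSum-++ F (map (f x) ys) _ ⟩
    listSum F (map (f x) ys) + listSum F (cartesianProductWith f xs ys)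
      ≈⟨ +-cong (row ys) (listSum-product f F≈KL xs ys) ⟩
    K x * listSum L ys + listSum K xs * listSum L ys
      ≈⟨ distribʳ _ _ _ ⟨
    (K x + listSum K xs) * listSum L ys ∎
    where
    row : ∀ ys → listSum F (map (f x) ys) ≈ K x * listSum L ys
    row []       = sym (zeroʳ _)
    row (y ∷ ys) = trans (+-cong (F≈KL x y) (row ys)) (sym (distribˡ _ _ _))

  listSum-upTo : ∀ n {A : Set p} (f : ℕ → A) (F : A → Carrier) →
                 listSum F (applyUpTo f n) ≈ sum {n} (F ∘ f ∘ toℕ)
  listSum-upTo zero    f F = refl
  listSum-upTo (suc n) f F = +-congˡ (listSum-upTo n (f ∘ suc) F)

-- Fourier inversion on a finite abelian group

module Fourier {R : CommutativeRing a b} (G : AbelianGroup c ℓ) {h : ℕ}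
         (enum : HasCardinality (AbelianGroup.setoid G) h) (roots : RootsOfUnity R h) where

  open CommutativeRing R
  open Exp commutativeSemiring
  open Mult semiring using () renaming (_×_ to _·_)
  open Sum semiring
  open RootsOfUnity roots
  open SetoidReasoning setoid
  open CommutativeSemigroupProperties *-commutativeSemigroup
    using (x∙yz≈y∙xz)
  private module G = AbelianGroup G
  open G using (_∙_; ε; _⁻¹)
  open CommutativeMonoidMult G.commutativeMonoid using () renaming (_×_ to _·ᴳ_)
  open Translation G enum
  open ListSum R
  open RawSemiring (Semiring.rawSemiring semiring) using (product)

  -- Values need not be given as units: χ (x ⁻¹) is an inverse of χ x.
  record Char : Set (a ⊔ b ⊔ c ⊔ ℓ) where
    infix 30 _⟪_⟫
    field
      _⟪_⟫   : G.Carrier → Carrier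
      χ-cong : ∀ {x y} → x G.≈ y → _⟪_⟫ x ≈ _⟪_⟫ y
      χ-∙    : ∀ x y → _⟪_⟫ (x ∙ y) ≈ _⟪_⟫ x * _⟪_⟫ y
      χ-ε    : _⟪_⟫ ε ≈ 1#

  open Char

  module _ (χ : Char) where

    χ-inverseʳ : ∀ x → χ ⟪ x ⟫ * χ ⟪ x ⁻¹ ⟫ ≈ 1#
    χ-inverseʳ x = trans (sym (χ-∙ χ x (x ⁻¹))) (trans (χ-cong χ (G.inverseʳ x)) (χ-ε χ))

    χ-· : ∀ n x → χ ⟪ n ·ᴳ x ⟫ ≈ χ ⟪ x ⟫ ^ n
    χ-· zero    x = χ-ε χ
    χ-· (suc n) x = trans (χ-∙ χ x (n ·ᴳ x)) (*-congˡ (χ-· n x))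

    χ^h≈1 : ∀ x → χ ⟪ x ⟫ ^ h ≈ 1#
    χ^h≈1 x = trans (sym (χ-· h x)) (trans (χ-cong χ (order·x≈ε x)) (χ-ε χ))

  *^h≈1 : ∀ {z w} → z ^ h ≈ 1# → w ^ h ≈ 1# → (z * w) ^ h ≈ 1#
  *^h≈1 {z} {w} zʰ≈1 wʰ≈1 = trans (^-distrib-* z w h) (trans (*-cong zʰ≈1 wʰ≈1) (*-identityˡ 1#))

  apart⇒≉ : ∀ {z w} → Apart R z w → ¬ z ≈ w
  apart⇒≉ z#w z≈w = nontrivial (z#w 1# (*-congʳ z≈w))

  -- Values of characters are h-th roots of unity, hence separated, and finitely many arguments
  -- represent all of G.
  agree : ∀ (χ ψ : Char) →
          (∀ x → χ ⟪ x ⟫ ≈ ψ ⟪ x ⟫) ⊎ ∃ λ x → Apart R (χ ⟪ x ⟫) (ψ ⟪ x ⟫)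
  agree χ ψ with ∀⊎∃ (λ i → separated _ _ (χ^h≈1 χ (elem i)) (χ^h≈1 ψ (elem i)))
  ... | inj₂ (i , χ#ψ) = inj₂ (elem i , χ#ψ)
  ... | inj₁ χ≈ψ       = inj₁ λ x → trans (χ-cong χ (G.sym (elem-index x)))
                           (trans (χ≈ψ (index x)) (χ-cong ψ (elem-index x)))

  module _ (k : Fin h → Fin h) where

    -- A candidate character, coded by the root indices of its values along the enumeration. Codes
    -- range over a finite type, and a system of eigenvalues of translations is such a code.
    weight : G.Carrier → Carrier
    weight x = root (k (index x))

    weight-cong : ∀ {x y} → x G.≈ y → weight x ≈ weight y
    weight-cong x≈y = reflexive (≡.cong (root ∘ k) (index-cong x≈y))

    weight^h≈1 : ∀ x → weight x ^ h ≈ 1#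
    weight^h≈1 x = root^h (k (index x))

    multiplicative? : (∀ x y → weight (x ∙ y) ≈ weight x * weight y) ⊎
                      ∃₂ λ x y → Apart R (weight (x ∙ y)) (weight x * weight y)
    multiplicative? with ∀⊎∃ (λ i → ∀⊎∃ λ j →
      separated (weight (elem i ∙ elem j)) (weight (elem i) * weight (elem j))
        (weight^h≈1 _) (*^h≈1 (weight^h≈1 _) (weight^h≈1 _)))
    ... | inj₂ (i , j , apart) = inj₂ (elem i , elem j , apart)
    ... | inj₁ mult            = inj₁ λ x y → begin
      weight (x ∙ y)
        ≈⟨ weight-cong (G.∙-cong (elem-index x) (elem-index y)) ⟨
      weight (elem (index x) ∙ elem (index y))
        ≈⟨ mult (index x) (index y) ⟩
      weight (elem (index x)) * weight (elem (index y))
        ≈⟨ *-cong (weight-cong (elem-index x)) (weight-cong (elem-index y)) ⟩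
      weight x * weight y ∎

    character : (∀ x y → weight (x ∙ y) ≈ weight x * weight y) →
                Σ Char λ χ → ∀ x → χ ⟪ x ⟫ ≈ weight x
    character mult = record
      { _⟪_⟫ = weight ; χ-cong = weight-cong ; χ-∙ = mult ; χ-ε = weight-ε } , λ x → refl
      where
      -- The value at ε is idempotent, so if it is apart from 1 it is 0, against its h-th power
      -- being 1. That h is positive is witnessed by `index ε`.
      weight-ε : weight ε ≈ 1#
      weight-ε with separated (weight ε) 1# (weight^h≈1 ε) (1^n≈1 R h)
      ... | inj₁ w≈1 = w≈1
      ... | inj₂ w#1 = ⊥-elim (nontrivial (begin
        1#             ≈⟨ weight^h≈1 ε ⟨
        weight ε ^ h   ≈⟨ ^-congˡ h w≈0 ⟩
        0# ^ h         ≈⟨ 0^h≈0 h (index ε) ⟩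
        0#             ∎))
        where
        w≈0 : weight ε ≈ 0#
        w≈0 = w#1 (weight ε) (begin
          weight ε * weight ε   ≈⟨ mult ε ε ⟨
          weight (ε ∙ ε)        ≈⟨ weight-cong (G.identityˡ ε) ⟩
          weight ε              ≈⟨ *-identityˡ _ ⟨
          1# * weight ε         ∎)
        0^h≈0 : ∀ n → Fin n → 0# ^ n ≈ 0#
        0^h≈0 (suc n) _ = zeroˡ _

  Charˢ : Setoid _ _
  Charˢ = record
    { Carrier = Char
    ; _≈_ = λ χ ψ → ∀ x → χ ⟪ x ⟫ ≈ ψ ⟪ x ⟫
    ; isEquivalence = record
      { refl  = λ x → refl
      ; sym   = λ p x → sym (p x)
      ; trans = λ p q x → trans (p x) (q x)
      }
    }

  correlation-same : ∀ (χ ψ : Char) → (∀ x → χ ⟪ x ⟫ ≈ ψ ⟪ x ⟫) →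
                     sum (λ i → ψ ⟪ elem i ⟫ * χ ⟪ elem i ⁻¹ ⟫) ≈ h · 1#
  correlation-same χ ψ χ≈ψ = begin
    sum (λ i → ψ ⟪ elem i ⟫ * χ ⟪ elem i ⁻¹ ⟫)
      ≈⟨ sum-cong-≋ (λ i → trans (*-congʳ (sym (χ≈ψ (elem i)))) (χ-inverseʳ χ (elem i))) ⟩
    sum {h} (λ _ → 1#)  ≈⟨ sum-replicate h ⟩
    h · 1#              ∎

  -- Translating the summation variable by x shows that χ x and ψ x multiply the sum to the same
  -- value; apartness then kills it.
  correlation-apart : ∀ (χ ψ : Char) x → Apart R (χ ⟪ x ⟫) (ψ ⟪ x ⟫) →
                      sum (λ i → ψ ⟪ elem i ⟫ * χ ⟪ elem i ⁻¹ ⟫) ≈ 0#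
  correlation-apart χ ψ x χ#ψ = χ#ψ A (begin
    χ ⟪ x ⟫ * A
      ≈⟨ *-congˡ (sum-translate +-commutativeMonoid f f-cong x) ⟨
    χ ⟪ x ⟫ * sum (λ i → f (elem i ∙ x))
      ≈⟨ *-distribˡ-sum _ (λ i → f (elem i ∙ x)) ⟩
    sum (λ i → χ ⟪ x ⟫ * f (elem i ∙ x))
      ≈⟨ sum-cong-≋ (λ i → step (elem i)) ⟩
    sum (λ i → ψ ⟪ x ⟫ * f (elem i))
      ≈⟨ *-distribˡ-sum _ (f ∘ elem) ⟨
    ψ ⟪ x ⟫ * A ∎)
    where
    open AbelianGroupProperties G using (⁻¹-∙-comm)
    f : G.Carrier → Carrier
    f y = ψ ⟪ y ⟫ * χ ⟪ y ⁻¹ ⟫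
    f-cong : ∀ {y z} → y G.≈ z → f y ≈ f z
    f-cong y≈z = *-cong (χ-cong ψ y≈z) (χ-cong χ (G.⁻¹-cong y≈z))
    A : Carrier
    A = sum (f ∘ elem)
    step : ∀ y → χ ⟪ x ⟫ * f (y ∙ x) ≈ ψ ⟪ x ⟫ * f y
    step y = begin
      χ ⟪ x ⟫ * (ψ ⟪ y ∙ x ⟫ * χ ⟪ (y ∙ x) ⁻¹ ⟫)
        ≈⟨ x∙yz≈y∙xz _ _ _ ⟩
      ψ ⟪ y ∙ x ⟫ * (χ ⟪ x ⟫ * χ ⟪ (y ∙ x) ⁻¹ ⟫)
        ≈⟨ *-cong (trans (χ-∙ ψ y x) (*-comm _ _))
             (*-congˡ (trans (χ-cong χ (G.sym (⁻¹-∙-comm y x))) (χ-∙ χ (y ⁻¹) (x ⁻¹)))) ⟩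
      ψ ⟪ x ⟫ * ψ ⟪ y ⟫ * (χ ⟪ x ⟫ * (χ ⟪ y ⁻¹ ⟫ * χ ⟪ x ⁻¹ ⟫))
        ≈⟨ *-congˡ (x∙yz≈y∙xz _ _ _) ⟩
      ψ ⟪ x ⟫ * ψ ⟪ y ⟫ * (χ ⟪ y ⁻¹ ⟫ * (χ ⟪ x ⟫ * χ ⟪ x ⁻¹ ⟫))
        ≈⟨ *-congˡ (trans (*-congˡ (χ-inverseʳ χ x)) (*-identityʳ _)) ⟩
      ψ ⟪ x ⟫ * ψ ⟪ y ⟫ * χ ⟪ y ⁻¹ ⟫
        ≈⟨ *-assoc _ _ _ ⟩
      ψ ⟪ x ⟫ * (ψ ⟪ y ⟫ * χ ⟪ y ⁻¹ ⟫) ∎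

  -- Eigenfunctions of translations

  Congruent : (G.Carrier → Carrier) → Set _
  Congruent f = ∀ {x y} → x G.≈ y → f x ≈ f y

  Eigen : (G.Carrier → Carrier) → G.Carrier → Set _
  Eigen f x = ∃ λ j → ∀ y → f (y ∙ x) ≈ root j * f y

  -- With T the translation by x and λ = `root j`, this is the sum of λ^i T^(-i) f over i < h: h
  -- times the projection of f to the λ-eigenspace of T.
  component : Fin h → G.Carrier → (G.Carrier → Carrier) → G.Carrier → Carrier
  component j x f y = sum (λ (i : Fin h) → root j ^ toℕ i * f (y ∙ toℕ i ·ᴳ (x ⁻¹)))

  module _ (x : G.Carrier) {f : G.Carrier → Carrier} (f-cong : Congruent f) where

    component-cong : ∀ j → Congruent (component j x f)
    component-cong j y≈z = sum-cong-≋ {h} λ i → *-congˡ (f-cong (G.∙-congʳ y≈z))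

    component-eigen : ∀ j → Eigen (component j x f) x
    component-eigen j = j , λ y → let
        F : ℕ → Carrier
        F i = root j ^ i * f (y ∙ x ∙ i ·ᴳ (x ⁻¹))
      in begin
      sum {h} (F ∘ toℕ)
        ≈⟨ sum-shift +-commutativeMonoid h F
             (*-cong (root^h j) (f-cong (G.∙-congˡ (order·x≈ε (x ⁻¹))))) ⟨
      sum {h} (F ∘ suc ∘ toℕ)
        ≈⟨ sum-cong-≋ {h} (λ i → trans (*-assoc _ _ _)
             (*-congˡ (*-congˡ (f-cong (step y (toℕ i ·ᴳ (x ⁻¹))))))) ⟩
      sum {h} (λ i → root j * (root j ^ toℕ i * f (y ∙ toℕ i ·ᴳ (x ⁻¹))))
        ≈⟨ *-distribˡ-sum {h} (root j) _ ⟨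
      root j * component j x f y ∎
      where
      step : ∀ y z → y ∙ x ∙ (x ⁻¹ ∙ z) G.≈ y ∙ z
      step y z = G.trans (G.assoc _ _ _) (G.∙-congˡ (\\-leftDividesˡ x z))
        where open AbelianGroupProperties G using (\\-leftDividesˡ)

    -- Translations commute, so splitting along x loses no eigenvalue already obtained.
    component-preserves-eigen : ∀ j {z} → Eigen f z → Eigen (component j x f) z
    component-preserves-eigen j {z} (l , f-eigen) = l , λ y → begin
      sum {h} (λ i → root j ^ toℕ i * f (y ∙ z ∙ toℕ i ·ᴳ (x ⁻¹)))
        ≈⟨ sum-cong-≋ {h} (λ i → trans
             (*-congˡ (trans (f-cong (swap y z _)) (f-eigen _))) (x∙yz≈y∙xz _ _ _)) ⟩
      sum {h} (λ i → root l * (root j ^ toℕ i * f (y ∙ toℕ i ·ᴳ (x ⁻¹))))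
        ≈⟨ *-distribˡ-sum {h} (root l) _ ⟨
      root l * component j x f y ∎
      where
      open CommutativeSemigroupProperties G.commutativeSemigroup using ()
        renaming (xy∙z≈xz∙y to swap)

    -- Summing over j first puts the i-th power sum of the roots in front of the i-th translate;
    -- only the translate with i = 0, which is f itself, remains.
    sum-component : ∀ y → sum (λ j → component j x f y) ≈ h · 1# * f y
    sum-component y = begin
      sum {h} (λ j → sum {h} (λ i → root j ^ toℕ i * g (toℕ i)))
        ≈⟨ ∑-comm {h} {h} _ ⟩
      sum {h} (λ i → sum {h} (λ j → root j ^ toℕ i * g (toℕ i)))
        ≈⟨ sum-cong-≋ {h} (λ i → *-distribʳ-sum {h} (g (toℕ i)) _) ⟨
      sum {h} (λ i → S (toℕ i) * g (toℕ i))
        ≈⟨ only-zero h (λ i → S i * g i)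
             (λ i 0<i i<h → trans (*-congʳ (sum-root i 0<i i<h)) (zeroˡ _)) (index x) ⟩
      S 0 * g 0
        ≈⟨ *-cong (sum-replicate h) (f-cong (G.identityʳ y)) ⟩
      h · 1# * f y ∎
      where
      g : ℕ → Carrier
      g i = f (y ∙ i ·ᴳ (x ⁻¹))
      S : ℕ → Carrier
      S i = sum {h} (λ j → root j ^ i)
      only-zero : ∀ n (F : ℕ → Carrier) → (∀ i → 0 ℕ.< i → i ℕ.< n → F i ≈ 0#) →
                  Fin n → sum {n} (F ∘ toℕ) ≈ F 0
      only-zero (suc n) F F≈0 _ = sum-only +-commutativeMonoid {f = F ∘ toℕ} Fin.zero λ where
        Fin.zero    0≢0 → ⊥-elim (0≢0 ≡.refl)
        (Fin.suc i) _   → F≈0 _ (s≤s z≤n) (Finₚ.toℕ<n (Fin.suc i))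

  Charᵈ : DecSetoid _ _
  Charᵈ = record
    { isDecEquivalence = record
      { isEquivalence = Setoid.isEquivalence Charˢ
      ; _≟_ = decide
      }
    }
    where
    decide : ∀ χ ψ → _
    decide χ ψ with agree χ ψ
    ... | inj₁ χ≈ψ         = yes χ≈ψ
    ... | inj₂ (x , apart) = no λ χ≈ψ → apart⇒≉ apart (χ≈ψ x)

  -- All h^h codes are tried and the multiplicative ones kept; `complete` gives the code of an
  -- arbitrary character.
  characters-finite : Finite (Charˢ)
  characters-finite = enumeration⇒finite Charᵈ {concatMap (candidates ∘ finToFun) (allFin _)} λ χ →
    Anyₚ.concatMap⁺ (candidates ∘ finToFun)
      (Anyₚ.tabulate⁺ (funToFin (exponent χ)) (member χ _ λ i →
        trans (proj₂ (complete (χ ⟪ elem i ⟫) (χ^h≈1 χ (elem i))))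
              (reflexive (≡.cong root (≡.sym (Finₚ.finToFun-funToFin (exponent χ) i))))))
    where
    candidates : (Fin h → Fin h) → List Char
    candidates k with multiplicative? k
    ... | inj₁ mult = proj₁ (character k mult) ∷ []
    ... | inj₂ _    = []
    exponent : Char → Fin h → Fin h
    exponent χ i = proj₁ (complete (χ ⟪ elem i ⟫) (χ^h≈1 χ (elem i)))
    member : ∀ χ k → (∀ i → χ ⟪ elem i ⟫ ≈ root (k i)) →
             Any (λ ψ → ∀ x → χ ⟪ x ⟫ ≈ ψ ⟪ x ⟫) (candidates k)
    member χ k χ≈k = go
      where
      χ-weight : ∀ x → χ ⟪ x ⟫ ≈ weight k x
      χ-weight x = trans (χ-cong χ (G.sym (elem-index x))) (χ≈k (index x))
      go : Any (λ ψ → ∀ x → χ ⟪ x ⟫ ≈ ψ ⟪ x ⟫) (candidates k)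
      go with multiplicative? k
      ... | inj₁ mult = here λ x → trans (χ-weight x) (sym (proj₂ (character k mult) x))
      ... | inj₂ (x , y , apart) = ⊥-elim (apart⇒≉ apart (begin
        weight k (x ∙ y)           ≈⟨ χ-weight (x ∙ y) ⟨
        χ ⟪ x ∙ y ⟫                ≈⟨ χ-∙ χ x y ⟩
        χ ⟪ x ⟫ * χ ⟪ y ⟫          ≈⟨ *-cong (χ-weight x) (χ-weight y) ⟩
        weight k x * weight k y    ∎))

  -- χ turns the weighted sum into a product of powers χ (r i)^(f i), so the sum over tuples factors
  -- one coordinate at a time, just as `exponents` builds them.
  product-expand : ∀ (χ : Char) {g} (r : Vector G.Carrier g) (e : Vector ℕ g) →
    listSum (λ f → χ ⟪ weightedSum G enum r f ⟫) (exponents e) ≈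
    product (λ i → sum {suc (e i)} (λ k → χ ⟪ r i ⟫ ^ toℕ k))
  product-expand χ {zero}  r e = trans (+-identityʳ _) (χ-ε χ)
  product-expand χ {suc g} r e = begin
    listSum (λ f → χ ⟪ weightedSum G enum r f ⟫) (exponents e)
      ≈⟨ listSum-product Vector._∷_ (λ k f → trans (χ-∙ χ _ _) (*-congʳ (χ-· χ k (r Fin.zero))))
           (upTo (suc (e Fin.zero))) (exponents (Vector.tail e)) ⟩
    listSum (λ k → χ ⟪ r Fin.zero ⟫ ^ k) (upTo (suc (e Fin.zero))) *
    listSum (λ f → χ ⟪ weightedSum G enum (Vector.tail r) f ⟫) (exponents (Vector.tail e))
      ≈⟨ *-cong (listSum-upTo (suc (e Fin.zero)) (λ k → k) _) (product-expand χ (Vector.tail r) (Vector.tail e)) ⟩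
    product (λ i → sum {suc (e i)} (λ k → χ ⟪ r i ⟫ ^ toℕ k)) ∎

  -- The inversion formula, for an arbitrary enumeration of the characters

  module Inversion (finite : Finite Charˢ) where

    private n = proj₁ finite

    dual : Fin n → Char
    dual = Inverse.from (proj₂ finite)

    -- The sum of χ (x - y) over all χ, with the dependence on x and on y kept in separate factors.
    kernel : G.Carrier → G.Carrier → Carrier
    kernel x y = sum (λ j → dual j ⟪ y ⁻¹ ⟫ * dual j ⟪ x ⟫)

    -- Fourier inversion for f, multiplied through by h.
    Inverts : (G.Carrier → Carrier) → Set _
    Inverts f = ∀ x → sum (λ i → f (elem i) * kernel x (elem i)) ≈ h · 1# * f x

    inverts-cong : ∀ {f g} → (∀ x → f x ≈ g x) → Inverts f → Inverts g
    inverts-cong f≈g inv x = begin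
      sum (λ i → _ * kernel x (elem i))  ≈⟨ sum-cong-≋ {h} (λ i → *-congʳ (f≈g (elem i))) ⟨
      sum (λ i → _ * kernel x (elem i))  ≈⟨ inv x ⟩
      h · 1# * _                         ≈⟨ *-congˡ (f≈g x) ⟩
      h · 1# * _                         ∎

    inverts-scale : ∀ r {f} → Inverts f → Inverts (λ x → r * f x)
    inverts-scale r {f} inv x = begin
      sum (λ i → r * f (elem i) * kernel x (elem i))    ≈⟨ sum-cong-≋ {h} (λ i → *-assoc _ _ _) ⟩
      sum (λ i → r * (f (elem i) * kernel x (elem i)))  ≈⟨ *-distribˡ-sum {h} r _ ⟨
      r * sum (λ i → f (elem i) * kernel x (elem i))    ≈⟨ *-congˡ (inv x) ⟩
      r * (h · 1# * f x)                                ≈⟨ x∙yz≈y∙xz _ _ _ ⟩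
      h · 1# * (r * f x)                                ∎

    inverts-sum : ∀ {m} (f : Fin m → G.Carrier → Carrier) → (∀ j → Inverts (f j)) →
                  Inverts (λ x → sum (λ j → f j x))
    inverts-sum {m} f inv x = begin
      sum {h} (λ i → sum {m} (λ j → f j (elem i)) * kernel x (elem i))
        ≈⟨ sum-cong-≋ {h} (λ i → *-distribʳ-sum {m} _ _) ⟩
      sum {h} (λ i → sum {m} (λ j → f j (elem i) * kernel x (elem i)))
        ≈⟨ ∑-comm {h} {m} _ ⟩
      sum {m} (λ j → sum {h} (λ i → f j (elem i) * kernel x (elem i)))
        ≈⟨ sum-cong-≋ {m} (λ j → inv j x) ⟩
      sum {m} (λ j → h · 1# * f j x)
        ≈⟨ *-distribˡ-sum {m} _ _ ⟨
      h · 1# * sum {m} (λ j → f j x) ∎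

    inverts-zero : ∀ {f} → (∀ x → f x ≈ 0#) → Inverts f
    inverts-zero f≈0 = inverts-cong (λ x → sym (f≈0 x)) (inverts-sum {0} (λ ()) λ ())

    -- Exchanging the sums produces the correlation of ψ with each enumerated character; all vanish
    -- except at the index of ψ, where it is h.
    inverts-character : ∀ ψ → Inverts (ψ ⟪_⟫)
    inverts-character ψ x = begin
      sum {h} (λ i → ψ ⟪ elem i ⟫ * sum {n} (λ j → dual j ⟪ elem i ⁻¹ ⟫ * dual j ⟪ x ⟫))
        ≈⟨ sum-cong-≋ {h} (λ i → *-distribˡ-sum {n} _ _) ⟩
      sum {h} (λ i → sum {n} (λ j → ψ ⟪ elem i ⟫ * (dual j ⟪ elem i ⁻¹ ⟫ * dual j ⟪ x ⟫)))
        ≈⟨ ∑-comm {h} {n} _ ⟩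
      sum {n} (λ j → sum {h} (λ i → ψ ⟪ elem i ⟫ * (dual j ⟪ elem i ⁻¹ ⟫ * dual j ⟪ x ⟫)))
        ≈⟨ sum-cong-≋ {n} (λ j → sum-cong-≋ {h} (λ i → *-assoc _ _ _)) ⟨
      sum {n} (λ j → sum {h} (λ i → ψ ⟪ elem i ⟫ * dual j ⟪ elem i ⁻¹ ⟫ * dual j ⟪ x ⟫))
        ≈⟨ sum-cong-≋ {n} (λ j → *-distribʳ-sum {h} _ _) ⟨
      sum {n} (λ j → sum {h} (λ i → ψ ⟪ elem i ⟫ * dual j ⟪ elem i ⁻¹ ⟫) * dual j ⟪ x ⟫)
        ≈⟨ sum-only +-commutativeMonoid ψᵢ vanish ⟩
      sum {h} (λ i → ψ ⟪ elem i ⟫ * dual ψᵢ ⟪ elem i ⁻¹ ⟫) * dual ψᵢ ⟪ x ⟫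
        ≈⟨ *-cong (correlation-same (dual ψᵢ) ψ dual-ψᵢ) (dual-ψᵢ x) ⟩
      h · 1# * ψ ⟪ x ⟫ ∎
      where
      ψᵢ : Fin n
      ψᵢ = Inverse.to (proj₂ finite) ψ
      dual-ψᵢ : ∀ x → dual ψᵢ ⟪ x ⟫ ≈ ψ ⟪ x ⟫
      dual-ψᵢ = Inverse.strictlyInverseʳ (proj₂ finite) ψ
      vanish : ∀ j → j ≢ ψᵢ →
               sum {h} (λ i → ψ ⟪ elem i ⟫ * dual j ⟪ elem i ⁻¹ ⟫) * dual j ⟪ x ⟫ ≈ 0#
      vanish j j≢ψᵢ with agree (dual j) ψ
      ... | inj₂ (y , apart) = trans (*-congʳ (correlation-apart (dual j) ψ y apart)) (zeroˡ _)
      ... | inj₁ j≈ψ = ⊥-elim (j≢ψᵢ (≡.trans (≡.sym (Inverse.strictlyInverseˡ (proj₂ finite) j))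
                                              (Inverse.to-cong (proj₂ finite) j≈ψ)))

    -- A joint eigenfunction of all translations is a multiple of a character,
    -- unless its eigenvalues are not multiplicative, when it vanishes.
    inverts-eigen : ∀ {f} → Congruent f → (∀ i → Eigen f (elem i)) → Inverts f
    inverts-eigen {f} f-cong eigen with multiplicative? (λ i → proj₁ (eigen i))
    ... | inj₁ mult = inverts-cong f-ψ (inverts-scale (f ε) (inverts-character ψ))
      where
      k : Fin h → Fin h
      k i = proj₁ (eigen i)
      ψ : Char
      ψ = proj₁ (character k mult)
      f-ψ : ∀ x → f ε * ψ ⟪ x ⟫ ≈ f x
      f-ψ x = begin
        f ε * ψ ⟪ x ⟫           ≈⟨ *-comm _ _ ⟩
        ψ ⟪ x ⟫ * f ε           ≈⟨ proj₂ (eigen (index x)) ε ⟨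
        f (ε ∙ elem (index x))  ≈⟨ f-cong (G.trans (G.identityˡ _) (elem-index x)) ⟩
        f x                     ∎
    -- Translating z by x ∙ y at once or in two steps multiplies f z by two factors that are apart,
    -- so f z is 0.
    ... | inj₂ (x , y , apart) = inverts-zero λ z → apart (f z) (begin
      weight k (x ∙ y) * f z             ≈⟨ f-weight z (x ∙ y) ⟨
      f (z ∙ (x ∙ y))                    ≈⟨ f-cong (G.trans (G.∙-congˡ (G.comm x y)) (G.sym (G.assoc z y x))) ⟩
      f (z ∙ y ∙ x)                      ≈⟨ f-weight (z ∙ y) x ⟩
      weight k x * f (z ∙ y)             ≈⟨ *-congˡ (f-weight z y) ⟩
      weight k x * (weight k y * f z)    ≈⟨ *-assoc _ _ _ ⟨
      weight k x * weight k y * f z      ∎)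
      where
      k : Fin h → Fin h
      k i = proj₁ (eigen i)
      f-weight : ∀ z x → f (z ∙ x) ≈ weight k x * f z
      f-weight z x = trans (f-cong (G.∙-congˡ (G.sym (elem-index x)))) (proj₂ (eigen (index x)) z)

    -- The list holds the translations still to be diagonalised. For the head, f is h⁻¹ times the
    -- sum of its components, each of which gains this eigenvalue and keeps the earlier ones.
    inverts-diagonalise : ∀ (is : List (Fin h)) {f} → Congruent f →
                          (∀ i → i ∈ is ⊎ Eigen f (elem i)) → Inverts f
    inverts-diagonalise [] f-cong eigen = inverts-eigen f-cong λ i → case (eigen i)
      where
      case : ∀ {f i} → i ∈ [] ⊎ Eigen f (elem i) → Eigen f (elem i)
      case (inj₂ e) = e
    inverts-diagonalise (i₀ ∷ is) {f} f-cong eigen =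
      inverts-cong (λ x → begin
        h⁻¹ * sum (λ j → component j (elem i₀) f x)  ≈⟨ *-congˡ (sum-component (elem i₀) f-cong x) ⟩
        h⁻¹ * (h · 1# * f x)                         ≈⟨ *-assoc _ _ _ ⟨
        h⁻¹ * (h · 1#) * f x                         ≈⟨ *-congʳ (trans (*-comm _ _) h*h⁻¹) ⟩
        1# * f x                                     ≈⟨ *-identityˡ _ ⟩
        f x                                          ∎)
      (inverts-scale h⁻¹ (inverts-sum (λ j → component j (elem i₀) f) λ j →
        inverts-diagonalise is (component-cong (elem i₀) f-cong j) (eigen′ j)))
      where
      eigen′ : ∀ j i → i ∈ is ⊎ Eigen (component j (elem i₀) f) (elem i)
      eigen′ j i with eigen i
      ... | inj₁ (here ≡.refl) = inj₂ (component-eigen (elem i₀) f-cong j)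
      ... | inj₁ (there i∈is)  = inj₁ i∈is
      ... | inj₂ e             = inj₂ (component-preserves-eigen (elem i₀) f-cong j e)

    inverts : ∀ {f} → Congruent f → Inverts f
    inverts f-cong = inverts-diagonalise (allFin h) f-cong (λ i → inj₁ (∈-allFin i))

    δ : G.Carrier → Carrier
    δ x with _≈?_ G enum x ε
    ... | yes _ = 1#
    ... | no  _ = 0#

    δ-yes : ∀ {x} → x G.≈ ε → δ x ≈ 1#
    δ-yes {x} x≈ε with _≈?_ G enum x ε
    ... | yes _   = refl
    ... | no  x≉ε = ⊥-elim (x≉ε x≈ε)

    δ-no : ∀ {x} → ¬ x G.≈ ε → δ x ≈ 0#
    δ-no {x} x≉ε with _≈?_ G enum x ε
    ... | yes x≈ε = ⊥-elim (x≉ε x≈ε)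
    ... | no  _   = refl

    δ-cong : Congruent δ
    δ-cong {x} {y} x≈y with _≈?_ G enum x ε
    ... | yes x≈ε = sym (δ-yes (G.trans (G.sym x≈y) x≈ε))
    ... | no  x≉ε = sym (δ-no λ y≈ε → x≉ε (G.trans x≈y y≈ε))

    orthogonality : ∀ x → sum (λ j → dual j ⟪ x ⟫) ≈ h · 1# * δ x
    orthogonality x = begin
      sum (λ j → dual j ⟪ x ⟫)
        ≈⟨ sum-cong-≋ {n} (λ j → trans (*-congʳ
             (trans (χ-cong (dual j) elem⁻¹≈ε) (χ-ε (dual j)))) (*-identityˡ _)) ⟨
      kernel x (elem (index ε))
        ≈⟨ trans (*-congʳ (δ-yes (elem-index ε))) (*-identityˡ _) ⟨
      δ (elem (index ε)) * kernel x (elem (index ε))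
        ≈⟨ sum-only +-commutativeMonoid (index ε) (λ i i≢ → trans (*-congʳ (δ-no λ eᵢ≈ε →
             i≢ (≡.trans (≡.sym (index-elem i)) (index-cong eᵢ≈ε)))) (zeroˡ _)) ⟨
      sum (λ i → δ (elem i) * kernel x (elem i))
        ≈⟨ inverts δ-cong x ⟩
      h · 1# * δ x ∎
      where
      open AbelianGroupProperties G using (ε⁻¹≈ε)
      elem⁻¹≈ε : elem (index ε) ⁻¹ G.≈ ε
      elem⁻¹≈ε = G.trans (G.⁻¹-cong (elem-index ε)) ε⁻¹≈ε

    count-δ : ∀ {g} (r : Vector G.Carrier g) xs →
              length (filter (λ f → _≈?_ G enum (weightedSum G enum r f) G.ε) xs) · 1# ≈
              listSum (δ ∘ weightedSum G enum r) xs
    count-δ r []       = refl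
    count-δ {g} r (f ∷ xs) = go (P? f)
      where
      P? : ∀ f → Dec (weightedSum G enum r f G.≈ G.ε)
      P? f = _≈?_ G enum (weightedSum G enum r f) G.ε
      go : Dec (weightedSum G enum r f G.≈ G.ε) →
           length (filter P? (f ∷ xs)) · 1# ≈ listSum (δ ∘ weightedSum G enum r) (f ∷ xs)
      go (yes ≈ε) = trans (reflexive (≡.cong (λ l → length l · 1#) (filter-accept P? ≈ε)))
                      (+-cong (sym (δ-yes ≈ε)) (count-δ r xs))
      go (no  ≉ε) = trans (reflexive (≡.cong (λ l → length l · 1#) (filter-reject P? ≉ε)))
                      (trans (count-δ r xs) (sym (trans (+-congʳ (δ-no ≉ε)) (+-identityˡ _))))

    zeroSumCount-formula : ∀ {t} → h · 1# * t ≈ 1# → ∀ {g} (r : Vector G.Carrier g) (e : Vector ℕ g) →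
      zeroSumCount G enum r e · 1# ≈
      t * sum (λ j → product (λ i → sum {suc (e i)} (λ k → dual j ⟪ r i ⟫ ^ toℕ k)))
    zeroSumCount-formula {t} h*t≈1 r e = begin
      zeroSumCount G enum r e · 1#
        ≈⟨ count-δ r (exponents e) ⟩
      listSum (δ ∘ weightedSum G enum r) (exponents e)
        ≈⟨ trans (*-congʳ (trans (*-comm _ _) h*t≈1)) (*-identityˡ _) ⟨
      t * (h · 1#) * listSum (δ ∘ weightedSum G enum r) (exponents e)
        ≈⟨ *-assoc _ _ _ ⟩
      t * (h · 1# * listSum (δ ∘ weightedSum G enum r) (exponents e))
        ≈⟨ *-congˡ (listSum-* _ _ (exponents e)) ⟩
      t * listSum (λ f → h · 1# * δ (weightedSum G enum r f)) (exponents e)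
        ≈⟨ *-congˡ (listSum-cong (λ f → orthogonality (weightedSum G enum r f)) (exponents e)) ⟨
      t * listSum (λ f → sum (λ j → dual j ⟪ weightedSum G enum r f ⟫)) (exponents e)
        ≈⟨ *-congˡ (listSum-sum (λ j f → dual j ⟪ weightedSum G enum r f ⟫) (exponents e)) ⟩
      t * sum (λ j → listSum (λ f → dual j ⟪ weightedSum G enum r f ⟫) (exponents e))
        ≈⟨ *-congˡ (sum-cong-≋ (λ j → product-expand (dual j) r e)) ⟩
      t * sum (λ j → product (λ i → sum {suc (e i)} (λ k → dual j ⟪ r i ⟫ ^ toℕ k))) ∎

-- Rational and real numbers

open ≡ using (refl; cong; cong₂; subst; subst₂; sym; trans)
open +-*-Solver using (solve; con; _:=_; _:+_; _:*_; _:-_; :-_)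

q≤p⇒0≤p-q : ∀ {p q} → q ℚ.≤ p → 0ℚ ℚ.≤ p ℚ.- q
q≤p⇒0≤p-q {p} {q} q≤p = subst (ℚ._≤ p ℚ.- q) (ℚₚ.+-inverseʳ q) (ℚₚ.+-monoˡ-≤ (ℚ.- q) q≤p)

0≤p-q⇒q≤p : ∀ {p q} → 0ℚ ℚ.≤ p ℚ.- q → q ℚ.≤ p
0≤p-q⇒q≤p {p} {q} 0≤p-q = subst₂ ℚ._≤_ (ℚₚ.+-identityˡ q)
  (solve 2 (λ p q → p :- q :+ q := p) refl p q) (ℚₚ.+-monoˡ-≤ q 0≤p-q)

0≤p*q : ∀ {p q} → 0ℚ ℚ.≤ p → 0ℚ ℚ.≤ q → 0ℚ ℚ.≤ p ℚ.* q
0≤p*q {p} {q} 0≤p 0≤q =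
  ℚₚ.nonNegative⁻¹ _ {{ℚₚ.nonNeg*nonNeg⇒nonNeg p {{nonNegative 0≤p}} q {{nonNegative 0≤q}}}}

0<p*q : ∀ {p q} → 0ℚ ℚ.< p → 0ℚ ℚ.< q → 0ℚ ℚ.< p ℚ.* q
0<p*q {p} {q} 0<p 0<q = ℚₚ.positive⁻¹ _ {{ℚₚ.pos*pos⇒pos p {{positive 0<p}} q {{positive 0<q}}}}

0≤p+q : ∀ {p q} → 0ℚ ℚ.≤ p → 0ℚ ℚ.≤ q → 0ℚ ℚ.≤ p ℚ.+ q
0≤p+q 0≤p 0≤q = ℚₚ.+-mono-≤ 0≤p 0≤q

0≤p*p : ∀ p → 0ℚ ℚ.≤ p ℚ.* p
0≤p*p p with ℚₚ.≤-total 0ℚ p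
... | inj₁ 0≤p = 0≤p*q 0≤p 0≤p
... | inj₂ p≤0 = subst (0ℚ ℚ.≤_) (solve 1 (λ p → :- p :* :- p := p :* p) refl p) (0≤p*q 0≤-p 0≤-p)
  where
  0≤-p : 0ℚ ℚ.≤ ℚ.- p
  0≤-p = ℚₚ.neg-antimono-≤ p≤0

n/1≡mkℚ : ∀ n → + n ℚ./ 1 ≡ mkℚ (+ n) 0 (coprime-sym (1-coprimeTo n))
n/1≡mkℚ n = ℚₚ.↥p/↧p≡p (mkℚ (+ n) 0 (coprime-sym (1-coprimeTo n)))

suc/1 : ∀ n → + suc n ℚ./ 1 ≡ 1ℚ ℚ.+ + n ℚ./ 1
suc/1 n = trans (cong (ℚ._/ 1) (sym (cong (λ i → + 1 ℤ.+ i) (ℤₚ.*-identityʳ (+ n)))))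
  (cong (1ℚ ℚ.+_) (sym (n/1≡mkℚ n)))

archimedean : ∀ w {ε} → 0ℚ ℚ.< ε → ∃ λ m → w ℚ.< + m ℚ./ 1 ℚ.* ε
archimedean w@record{} {ε@(mkℚ +[1+ k ] d _)} _ = m , ℚₚ.toℚᵘ-cancel-< (begin-strict
  toℚᵘ w                             <⟨ ℚᵘ.*<* bound ⟩
  ℚᵘ.mkℚᵘ (+ m) 0 ℚᵘ.* toℚᵘ ε        ≡⟨ cong (λ q → toℚᵘ q ℚᵘ.* toℚᵘ ε) (n/1≡mkℚ m) ⟨
  toℚᵘ (+ m ℚ./ 1) ℚᵘ.* toℚᵘ ε       ≃⟨ ℚₚ.toℚᵘ-homo-* (+ m ℚ./ 1) ε ⟨
  toℚᵘ (+ m ℚ./ 1 ℚ.* ε)             ∎)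
  where
  open ℚᵘₚ.≤-Reasoning
  m : ℕ
  -- For w = a / b and ε = (k + 1) / (d + 1) this makes m ε exceed ∣a∣, hence w. The factor 1 is the
  -- denominator of m, left over from cross-multiplication.
  m = suc (ℤ.∣ ℚ.↥ w ∣ ℕ.* (1 ℕ.* suc d))
  i≤∣i∣ : ∀ i → i ℤ.≤ + ℤ.∣ i ∣
  i≤∣i∣ (+ n)      = ℤₚ.≤-refl
  i≤∣i∣ ℤ.-[1+ n ] = ℤ.-≤+
  module Z = ℤₚ.≤-Reasoning
  bound : ℚ.↥ w ℤ.* + (1 ℕ.* suc d) ℤ.< (+ m ℤ.* +[1+ k ]) ℤ.* ℚ.↧ w
  bound = Z.begin-strict
    ℚ.↥ w ℤ.* + (1 ℕ.* suc d)              Z.≤⟨ ℤₚ.*-monoʳ-≤-nonNeg (+ (1 ℕ.* suc d)) (i≤∣i∣ (ℚ.↥ w)) ⟩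
    + ℤ.∣ ℚ.↥ w ∣ ℤ.* + (1 ℕ.* suc d)      Z.≡⟨ ℤₚ.pos-* ℤ.∣ ℚ.↥ w ∣ (1 ℕ.* suc d) ⟨
    + (ℤ.∣ ℚ.↥ w ∣ ℕ.* (1 ℕ.* suc d))      Z.<⟨ ℤ.+<+ ℕₚ.≤-refl ⟩
    + m                                    Z.≤⟨ ℤ.+≤+ (ℕₚ.≤-trans (ℕₚ.m≤m*n m (suc k)) (ℕₚ.m≤m*n (m ℕ.* suc k) (ℚ.↧ₙ w))) ⟩
    + (m ℕ.* suc k ℕ.* ℚ.↧ₙ w)             Z.≡⟨ trans (ℤₚ.pos-* (m ℕ.* suc k) (ℚ.↧ₙ w)) (cong (ℤ._* ℚ.↧ w) (ℤₚ.pos-* m (suc k))) ⟩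
    + m ℤ.* + suc k ℤ.* ℚ.↧ w              Z.∎
archimedean w {mkℚ (+ 0) _ _}      (*<* (ℤ.+<+ ()))
archimedean w {mkℚ ℤ.-[1+ _ ] _ _} (*<* ())

-- Chebyshev polynomials of the second kind over ℚ

-- u j at x = 2 cos θ is sin jθ / sin θ.
u : ℚ → ℕ → ℚ
u x zero          = 0ℚ
u x (suc zero)    = 1ℚ
u x (suc (suc j)) = x ℚ.* u x (suc j) ℚ.- u x j

-- The difference u (j + 1)² - u (j + 2) u j is invariant, since the step matrix of the recurrence
-- has determinant 1.
u-cassini : ∀ x j → u x (suc j) ℚ.* u x (suc j) ≡ 1ℚ ℚ.+ u x (suc (suc j)) ℚ.* u x j
u-cassini x zero    = solve 1 (λ x → con 1ℚ :* con 1ℚ := con 1ℚ :+ (x :* con 1ℚ :- con 0ℚ) :* con 0ℚ) refl x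
u-cassini x (suc j) = trans
  (solve 3 (λ x a b → (x :* a :- b) :* (x :* a :- b)
    := a :* a :+ (x :* (x :* a :- b) :- a) :* a :- (x :* a :- b) :* b) refl x (u x (suc j)) (u x j))
  (trans (cong (λ c → c ℚ.+ u x (3 ℕ.+ j) ℚ.* u x (suc j) ℚ.- u x (2 ℕ.+ j) ℚ.* u x j) (u-cassini x j))
    (solve 2 (λ p q → con 1ℚ :+ p :+ q :- p := con 1ℚ :+ q) refl
      (u x (2 ℕ.+ j) ℚ.* u x j) (u x (3 ℕ.+ j) ℚ.* u x (suc j))))

-- The addition formula of the sine, by moving one step of the recurrence from j to i.
u-+ : ∀ x i j → u x (suc i ℕ.+ j) ≡ u x (suc i) ℚ.* u x (suc j) ℚ.- u x i ℚ.* u x j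
u-+ x i zero    = trans (cong (u x) (ℕₚ.+-identityʳ (suc i)))
  (solve 2 (λ a b → a := a :* con 1ℚ :- b :* con 0ℚ) refl (u x (suc i)) (u x i))
u-+ x i (suc j) = trans (cong (u x) (ℕₚ.+-suc (suc i) j)) (trans (u-+ x (suc i) j)
  (solve 5 (λ x a b c d → (x :* a :- b) :* c :- a :* d := a :* (x :* c :- d) :- b :* c) refl
    x (u x (suc i)) (u x i) (u x (suc j)) (u x j)))

-- Sturm comparison: the Wronskian of u at q and at y is nondecreasing in j.
u-mono : ∀ {q y} → q ℚ.≤ y → ∀ k → (∀ j → j ℕ.< k → 0ℚ ℚ.< u q (suc j)) →
         ∀ j → j ℕ.< k → u q (suc j) ℚ.≤ u y (suc j)
u-mono {q} {y} q≤y k pos j j<k = proj₁ (go j j<k)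
  where
  wronskian : ℕ → ℚ
  wronskian j = u y (suc j) ℚ.* u q j ℚ.- u q (suc j) ℚ.* u y j
  go : ∀ j → j ℕ.< k → u q (suc j) ℚ.≤ u y (suc j) × 0ℚ ℚ.≤ wronskian j
  go zero    _     = ℚₚ.≤-refl , ℚₚ.≤-refl
  go (suc j) 1+j<k with go j (ℕₚ.<⇒≤ 1+j<k)
  -- Write α′ and β′ for the next values. W′ = W + (y - q) α β ≥ 0 says α′ β ≥ β′ α, and β′ α ≥ β′ β
  -- by induction; then β cancels.
  ... | β≤α , 0≤W = ℚₚ.*-cancelʳ-≤-pos β {{positive 0<β}} (ℚₚ.≤-trans
      (ℚₚ.*-monoˡ-≤-nonNeg (u q (2 ℕ.+ j)) {{nonNegative (ℚₚ.<⇒≤ (pos (suc j) 1+j<k))}} β≤α) (0≤p-q⇒q≤p 0≤W′)) , 0≤W′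
    where
    α β : ℚ
    α = u y (suc j)
    β = u q (suc j)
    0<β : 0ℚ ℚ.< β
    0<β = pos j (ℕₚ.<⇒≤ 1+j<k)
    0≤W′ : 0ℚ ℚ.≤ wronskian (suc j)
    0≤W′ = subst (0ℚ ℚ.≤_)
      (solve 6 (λ q y a b c d → (y :- q) :* (a :* b) :+ (a :* d :- b :* c) := (y :* a :- c) :* b :- (q :* b :- d) :* a)
        refl q y α β (u y j) (u q j))
      (0≤p+q (0≤p*q (q≤p⇒0≤p-q q≤y) (0≤p*q (ℚₚ.≤-trans (ℚₚ.<⇒≤ 0<β) β≤α) (ℚₚ.<⇒≤ 0<β))) 0≤W)

-- Bisection over ℚ

distance-within : ∀ {l r p q} → l ℚ.≤ p → p ℚ.≤ r → l ℚ.≤ q → q ℚ.≤ r → ∣ p ℚ.- q ∣ ℚ.≤ r ℚ.- l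
distance-within {l} {r} {p} {q} l≤p p≤r l≤q q≤r with ℚₚ.∣p∣≡p∨∣p∣≡-p (p ℚ.- q)
... | inj₁ eq = subst (ℚ._≤ r ℚ.- l) (sym eq) (ℚₚ.+-mono-≤ p≤r (ℚₚ.neg-antimono-≤ l≤q))
... | inj₂ eq = subst (ℚ._≤ r ℚ.- l)
  (sym (trans eq (solve 2 (λ p q → :- (p :- q) := q :- p) refl p q)))
  (ℚₚ.+-mono-≤ q≤r (ℚₚ.neg-antimono-≤ l≤p))

module Bisection {P : Pred ℚ 0ℓ} (P? : Decidable P) where

  record Bracket : Set where
    field
      {lo hi} : ℚ
      ¬P-lo   : ¬ P lo
      P-hi    : P hi
      lo≤hi   : lo ℚ.≤ hi

  open Bracket

  width : Bracket → ℚ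
  width B = hi B ℚ.- lo B

  private
    mid : Bracket → ℚ
    mid B = ½ ℚ.* (lo B ℚ.+ hi B)

    lo≤mid : ∀ B → lo B ℚ.≤ mid B
    lo≤mid B = 0≤p-q⇒q≤p (subst (0ℚ ℚ.≤_)
      (solve 2 (λ l h → con ½ :* (h :- l) := con ½ :* (l :+ h) :- l) refl (lo B) (hi B))
      (0≤p*q (ℚₚ.nonNegative⁻¹ ½) (q≤p⇒0≤p-q (lo≤hi B))))

    mid≤hi : ∀ B → mid B ℚ.≤ hi B
    mid≤hi B = 0≤p-q⇒q≤p (subst (0ℚ ℚ.≤_)
      (solve 2 (λ l h → con ½ :* (h :- l) := h :- con ½ :* (l :+ h)) refl (lo B) (hi B))
      (0≤p*q (ℚₚ.nonNegative⁻¹ ½) (q≤p⇒0≤p-q (lo≤hi B))))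

  halve : Bracket → Bracket
  halve B with P? (mid B)
  ... | yes Pm = record { ¬P-lo = ¬P-lo B ; P-hi = Pm     ; lo≤hi = lo≤mid B }
  ... | no ¬Pm = record { ¬P-lo = ¬Pm     ; P-hi = P-hi B ; lo≤hi = mid≤hi B }

  width-halve : ∀ B → width (halve B) ≡ ½ ℚ.* width B
  width-halve B with P? (mid B)
  ... | yes _ = solve 2 (λ l h → con ½ :* (l :+ h) :- l := con ½ :* (h :- l)) refl (lo B) (hi B)
  ... | no  _ = solve 2 (λ l h → h :- con ½ :* (l :+ h) := con ½ :* (h :- l)) refl (lo B) (hi B)

  infix 4 _⊆_
  _⊆_ : Bracket → Bracket → Set
  B ⊆ C = lo C ℚ.≤ lo B × hi B ℚ.≤ hi C

  halve⊆ : ∀ B → halve B ⊆ B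
  halve⊆ B with P? (mid B)
  ... | yes _ = ℚₚ.≤-refl , mid≤hi B
  ... | no  _ = lo≤mid B , ℚₚ.≤-refl

  halves : ℕ → Bracket → Bracket
  halves zero    B = B
  halves (suc n) B = halves n (halve B)

  halves⊆ : ∀ B {N n} → N ℕ.≤ n → halves n B ⊆ halves N B
  halves⊆ B {n = zero}  z≤n       = ℚₚ.≤-refl , ℚₚ.≤-refl
  halves⊆ B {n = suc n} z≤n       =
    let l , r = halves⊆ (halve B) {0} {n} z≤n
        l′ , r′ = halve⊆ B
    in ℚₚ.≤-trans l′ l , ℚₚ.≤-trans r r′
  halves⊆ B             (s≤s N≤n) = halves⊆ (halve B) N≤n

  -- The crude bound 2^m ≥ m + 1 is enough for use with `archimedean`: one halving replaces m + 2 by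
  -- (m + 2) / 2 ≤ m + 1.
  width-halves : ∀ m B {ε} → 0ℚ ℚ.≤ ε → width B ℚ.< + suc m ℚ./ 1 ℚ.* ε → width (halves m B) ℚ.< ε
  width-halves zero    B {ε} 0≤ε w< = subst (width B ℚ.<_) (ℚₚ.*-identityˡ ε) w<
  width-halves (suc m) B {ε} 0≤ε w< = width-halves m (halve B) 0≤ε (begin-strict
    width (halve B)                        ≡⟨ width-halve B ⟩
    ½ ℚ.* width B                          <⟨ ℚₚ.*-monoʳ-<-pos ½ w< ⟩
    ½ ℚ.* (+ suc (suc m) ℚ./ 1 ℚ.* ε)      ≤⟨ 0≤p-q⇒q≤p (subst (0ℚ ℚ.≤_) difference
                                                (0≤p*q (0≤p*q (ℚₚ.nonNegative⁻¹ ½) 0≤m) 0≤ε)) ⟩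
    (1ℚ ℚ.+ + m ℚ./ 1) ℚ.* ε               ≡⟨ cong (ℚ._* ε) (suc/1 m) ⟨
    + suc m ℚ./ 1 ℚ.* ε                    ∎)
    where
    open ℚₚ.≤-Reasoning
    0≤m : 0ℚ ℚ.≤ + m ℚ./ 1
    0≤m = subst (0ℚ ℚ.≤_) (sym (n/1≡mkℚ m)) (ℚₚ.nonNegative⁻¹ _)
    2+m/1 : + suc (suc m) ℚ./ 1 ≡ 1ℚ ℚ.+ (1ℚ ℚ.+ + m ℚ./ 1)
    2+m/1 = trans (suc/1 (suc m)) (cong (1ℚ ℚ.+_) (suc/1 m))
    difference : ½ ℚ.* (+ m ℚ./ 1) ℚ.* ε ≡
                 (1ℚ ℚ.+ + m ℚ./ 1) ℚ.* ε ℚ.- ½ ℚ.* (+ suc (suc m) ℚ./ 1 ℚ.* ε)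
    difference = trans
      (solve 2 (λ m ε → con ½ :* m :* ε :=
        (con 1ℚ :+ m) :* ε :- con ½ :* ((con 1ℚ :+ (con 1ℚ :+ m)) :* ε)) refl (+ m ℚ./ 1) ε)
      (cong (λ q → (1ℚ ℚ.+ + m ℚ./ 1) ℚ.* ε ℚ.- ½ ℚ.* (q ℚ.* ε)) (sym 2+m/1))

  module _ (B : Bracket) where

    los his : Seq
    los n = lo (halves n B)
    his n = hi (halves n B)

    private
      Within : ℕ → ℚ → Set
      Within N p = los N ℚ.≤ p × p ℚ.≤ his N

      lo-within : ∀ {N n} → N ℕ.≤ n → Within N (los n)
      lo-within {N} {n} N≤n = proj₁ (halves⊆ B N≤n) , ℚₚ.≤-trans (lo≤hi (halves n B)) (proj₂ (halves⊆ B N≤n))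

      hi-within : ∀ {N n} → N ℕ.≤ n → Within N (his n)
      hi-within {N} {n} N≤n = ℚₚ.≤-trans (proj₁ (halves⊆ B N≤n)) (lo≤hi (halves n B)) , proj₂ (halves⊆ B N≤n)

      -- From N on all ends lie in the N-th bracket, so one modulus serves for `los`, for `his` and
      -- for their difference.
      close : ∀ ε → 0ℚ ℚ.< ε → ∃ λ N → ∀ {p q} → Within N p → Within N q → ∣ p ℚ.- q ∣ ℚ.< ε
      close ε 0<ε with archimedean (width B) 0<ε
      ... | m , w< = m , λ (l≤p , p≤h) (l≤q , q≤h) → ℚₚ.≤-<-trans (distance-within l≤p p≤h l≤q q≤h)
        (width-halves m B (ℚₚ.<⇒≤ 0<ε) (ℚₚ.<-≤-trans w<
          (ℚₚ.*-monoʳ-≤-nonNeg ε {{nonNegative (ℚₚ.<⇒≤ 0<ε)}} m≤1+m)))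
        where
        m≤1+m : + m ℚ./ 1 ℚ.≤ + suc m ℚ./ 1
        m≤1+m = subst₂ ℚ._≤_ (ℚₚ.+-identityˡ _) (sym (suc/1 m)) (ℚₚ.+-monoˡ-≤ (+ m ℚ./ 1) (ℚₚ.nonNegative⁻¹ 1ℚ))

    los-cauchy : Cauchy los
    los-cauchy ε 0<ε = let N , f = close ε 0<ε in
      N , λ m n N≤m N≤n → f (lo-within N≤m) (lo-within N≤n)

    his-cauchy : Cauchy his
    his-cauchy ε 0<ε = let N , f = close ε 0<ε in
      N , λ m n N≤m N≤n → f (hi-within N≤m) (hi-within N≤n)

    los~his : los ~ his
    los~his ε 0<ε = let N , f = close ε 0<ε in
      N , λ n N≤n → f (lo-within N≤n) (hi-within N≤n)

-- Chebyshev values at reals and their largest zeros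

private
  module ≈ᴿ = IsEquivalence ≈ᴿ-isEquivalence

uᴿ : ℝ → ℕ → ℝ
uᴿ x zero          = fromℚᴿ 0ℚ
uᴿ x (suc zero)    = fromℚᴿ 1ℚ
uᴿ x (suc (suc j)) = x *ᴿ uᴿ x (suc j) +ᴿ -ᴿ uᴿ x j

-- Real arithmetic is termwise, so identities and estimates for `u` over ℚ carry over index by
-- index.
seq-uᴿ : ∀ x j n → seq (uᴿ x j) n ≡ u (seq x n) j
seq-uᴿ x zero          n = refl
seq-uᴿ x (suc zero)    n = refl
seq-uᴿ x (suc (suc j)) n = cong₂ (λ a b → seq x n ℚ.* a ℚ.- b) (seq-uᴿ x (suc j) n) (seq-uᴿ x j n)

uᴿ-cong : ∀ {x y} → x ≈ᴿ y → ∀ j → uᴿ x j ≈ᴿ uᴿ y j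
uᴿ-cong x≈y zero          = ≈ᴿ.refl
uᴿ-cong x≈y (suc zero)    = ≈ᴿ.refl
uᴿ-cong x≈y (suc (suc j)) = +ᴿ-cong (*ᴿ-cong x≈y (uᴿ-cong x≈y (suc j))) (-ᴿ-cong (uᴿ-cong x≈y j))

p≤∣p∣ : ∀ p → p ℚ.≤ ∣ p ∣
p≤∣p∣ p with ℚₚ.≤-total 0ℚ p
... | inj₁ 0≤p = ℚₚ.≤-reflexive (sym (ℚₚ.0≤p⇒∣p∣≡p 0≤p))
... | inj₂ p≤0 = ℚₚ.≤-trans p≤0 (ℚₚ.0≤∣p∣ p)

≈ᴿ0⇒<1 : ∀ {x} → x ≈ᴿ fromℚᴿ 0ℚ → ∃ λ n → seq x n ℚ.< 1ℚ
≈ᴿ0⇒<1 {x} x≈0 = let N , f = seq~ x≈0 1ℚ (ℚₚ.positive⁻¹ 1ℚ) in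
  N , ℚₚ.≤-<-trans (p≤∣p∣ (seq x N)) (subst (λ p → ∣ p ∣ ℚ.< 1ℚ) (ℚₚ.+-identityʳ (seq x N)) (f N ℕₚ.≤-refl))

-- Termwise 0 ≤ y ≤ y - x, and y - x is null.
≈ᴿ0-squeeze : ∀ {x y} → x ≈ᴿ y → (∀ n → seq x n ℚ.≤ 0ℚ) → (∀ n → 0ℚ ℚ.≤ seq y n) → y ≈ᴿ fromℚᴿ 0ℚ
≈ᴿ0-squeeze {x} {y} x≈y x≤0 0≤y = mk≈ᴿ λ ε 0<ε →
  let N , f = seq~ x≈y ε 0<ε
  in N , λ n N≤n → ℚₚ.≤-<-trans
    (subst₂ (λ p q → ∣ p ∣ ℚ.≤ q) (sym (ℚₚ.+-identityʳ (seq y n))) refl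
      (ℚₚ.≤-trans (subst (ℚ._≤ seq y n ℚ.- seq x n) (sym (ℚₚ.0≤p⇒∣p∣≡p (0≤y n)))
        (subst (ℚ._≤ seq y n ℚ.- seq x n) (ℚₚ.+-identityʳ (seq y n)) (ℚₚ.+-monoʳ-≤ (seq y n) (ℚₚ.neg-antimono-≤ (x≤0 n)))))
        (p≤∣p∣ _)))
    (subst (ℚ._< ε) (dist-sym (seq x n) (seq y n)) (f n N≤n))
  where
  dist-sym : ∀ p q → ∣ p ℚ.- q ∣ ≡ ∣ q ℚ.- p ∣
  dist-sym p q = trans (cong ∣_∣ (solve 2 (λ p q → p :- q := :- (q :- p)) refl p q)) (ℚₚ.∣-p∣≡∣p∣ (q ℚ.- p))

2ℚ : ℚ
2ℚ = 1ℚ ℚ.+ 1ℚ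

-- At x = 2 the angle is 0 and u j is j. This makes 2 a right end for every bisection.
u2-suc : ∀ j → u 2ℚ (suc j) ≡ u 2ℚ j ℚ.+ 1ℚ
u2-suc zero    = refl
u2-suc (suc j) = trans (cong (λ a → 2ℚ ℚ.* a ℚ.- u 2ℚ j) (u2-suc j))
  (trans (solve 1 (λ b → con 2ℚ :* (b :+ con 1ℚ) :- b := (b :+ con 1ℚ) :+ con 1ℚ) refl (u 2ℚ j))
    (cong (ℚ._+ 1ℚ) (sym (u2-suc j))))

0≤u2 : ∀ j → 0ℚ ℚ.≤ u 2ℚ j
0≤u2 zero    = ℚₚ.≤-refl
0≤u2 (suc j) = subst (0ℚ ℚ.≤_) (sym (u2-suc j)) (0≤p+q (0≤u2 j) (ℚₚ.nonNegative⁻¹ 1ℚ))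

0<u2 : ∀ j → 0ℚ ℚ.< u 2ℚ (suc j)
0<u2 j = subst (0ℚ ℚ.<_) (sym (u2-suc j)) (ℚₚ.+-mono-≤-< (0≤u2 j) (ℚₚ.positive⁻¹ 1ℚ))

-- q lies in [2 cos (π / (k + 1)) , 2 cos (π / (k + 2))], up to endpoints.
Isolates : ℕ → ℚ → Set
Isolates k q = (∀ j → j ℕ.< suc k → 0ℚ ℚ.< u q (suc j)) × u q (2 ℕ.+ k) ℚ.≤ 0ℚ

module Root {k q} (isolates : Isolates k q) where

  private
    u-pos = proj₁ isolates

    q≤2 : q ℚ.≤ 2ℚ
    q≤2 with ℚₚ.≤-total q 2ℚ
    ... | inj₁ q≤2 = q≤2
    ... | inj₂ 2≤q = ⊥-elim (ℚₚ.<-irrefl refl (ℚₚ.<-≤-trans (0<u2 (suc k)) (ℚₚ.≤-trans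
      (u-mono 2≤q (2 ℕ.+ k) (λ j _ → 0<u2 j) (suc k) ℕₚ.≤-refl) (proj₂ isolates))))

    open Bisection (λ x → 0ℚ ℚₚ.<? u x (2 ℕ.+ k))

    start : Bracket
    start = record { ¬P-lo = (λ 0<u → ℚₚ.<-irrefl refl (ℚₚ.<-≤-trans 0<u (proj₂ isolates))) ; P-hi = 0<u2 (suc k) ; lo≤hi = q≤2 }

  -- The right ends are taken because u (k + 2) is positive there: each approximation is then a
  -- candidate for isolating the next zero.
  root : ℝ
  root = mkℝ (his start) (his-cauchy start)

  -- The bound does not depend on n, as inverting the real value requires.
  u-root-bound : ∀ n j → j ℕ.< suc k → u q (suc j) ℚ.≤ u (seq root n) (suc j)
  u-root-bound n = u-mono (ℚₚ.≤-trans (proj₁ (halves⊆ start {0} {n} z≤n)) (Bracket.lo≤hi (halves n start))) (suc k) u-pos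

  u-root-pos : ∀ n → 0ℚ ℚ.< u (seq root n) (2 ℕ.+ k)
  u-root-pos n = Bracket.P-hi (halves n start)

  -- Left and right ends represent the same real, with u (k + 2) at most 0 along the former and
  -- positive along the latter.
  u-root≈0 : uᴿ root (2 ℕ.+ k) ≈ᴿ fromℚᴿ 0ℚ
  u-root≈0 = ≈ᴿ0-squeeze {uᴿ left (2 ℕ.+ k)} (uᴿ-cong (mk≈ᴿ (los~his start)) (2 ℕ.+ k))
    (λ n → subst (ℚ._≤ 0ℚ) (sym (seq-uᴿ left (2 ℕ.+ k) n)) (ℚₚ.≮⇒≥ (Bracket.¬P-lo (halves n start))))
    (λ n → subst (0ℚ ℚ.≤_) (sym (seq-uᴿ root (2 ℕ.+ k) n)) (ℚₚ.<⇒≤ (u-root-pos n)))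
    where
    left : ℝ
    left = mkℝ (los start) (los-cauchy start)

  u-root-small : ∃ λ n → u (seq root n) (2 ℕ.+ k) ℚ.< 1ℚ
  u-root-small = let n , small = ≈ᴿ0⇒<1 u-root≈0 in n , subst (ℚ._< 1ℚ) (seq-uᴿ root (2 ℕ.+ k) n) small

-- If u (k + 3) were positive, Cassini's identity would make γ² exceed 1, against 0 < γ < 1. Hence
-- the threshold 1 in `u-root-small`.
isolates-suc : ∀ {k y} → (∀ j → j ℕ.< suc k → 0ℚ ℚ.< u y (suc j)) →
               0ℚ ℚ.< u y (2 ℕ.+ k) → u y (2 ℕ.+ k) ℚ.< 1ℚ → Isolates (suc k) y
isolates-suc {k} {y} u-pos 0<γ γ<1 = pos , ℚₚ.≮⇒≥ 0≮u
  where
  γ : ℚ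
  γ = u y (2 ℕ.+ k)
  pos : ∀ j → j ℕ.< 2 ℕ.+ k → 0ℚ ℚ.< u y (suc j)
  pos j j<2+k with ℕₚ.m<1+n⇒m<n∨m≡n j<2+k
  ... | inj₁ j<1+k = u-pos j j<1+k
  ... | inj₂ refl  = 0<γ
  0≮u : ¬ 0ℚ ℚ.< u y (3 ℕ.+ k)
  0≮u 0<u = ℚₚ.<-irrefl refl (begin-strict
    1ℚ                                            ≡⟨ ℚₚ.+-identityʳ 1ℚ ⟨
    1ℚ ℚ.+ 0ℚ                                     <⟨ ℚₚ.+-monoʳ-< 1ℚ (0<p*q 0<u (u-pos k ℕₚ.≤-refl)) ⟩
    1ℚ ℚ.+ u y (3 ℕ.+ k) ℚ.* u y (suc k)          ≡⟨ u-cassini y (suc k) ⟨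
    γ ℚ.* γ                                       <⟨ ℚₚ.*-monoˡ-<-pos γ {{positive 0<γ}} γ<1 ⟩
    1ℚ ℚ.* γ                                      ≡⟨ ℚₚ.*-identityˡ γ ⟩
    γ                                             <⟨ γ<1 ⟩
    1ℚ                                            ∎)
    where open ℚₚ.≤-Reasoning

-- For k = 0 the point 0 is itself the zero of u 2 = x. Afterwards a rational just right of the zero
-- of u (k + 2) lies left of the next zero.
isolating : ∀ k → ∃ (Isolates k)
isolating zero    = 0ℚ , (λ { zero _ → ℚₚ.positive⁻¹ 1ℚ ; (suc _) (s≤s ()) }) , ℚₚ.≤-refl
isolating (suc k) = refine (isolating k)
  where
  refine : ∃ (Isolates k) → ∃ (Isolates (suc k))
  refine (q , isolates) = seq root n , isolates-suc
    (λ j j<1+k → ℚₚ.<-≤-trans (proj₁ isolates j j<1+k) (u-root-bound n j j<1+k))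
    (u-root-pos n) (proj₂ u-root-small)
    where
    open Root isolates
    n : ℕ
    n = proj₁ u-root-small

-- Inverses in ℝ and ℂ, and locality of ℂ

EventuallyAbove : ℚ → ℝ → Set
EventuallyAbove δ x = ∃ λ N → ∀ n → N ℕ.≤ n → δ ℚ.≤ seq x n

reciprocal : ∀ p → 0ℚ ℚ.< p → ∃ λ i → i ℚ.* p ≡ 1ℚ
reciprocal p 0<p = ℚ.1/ p , ℚₚ.*-inverseˡ p
  where
  instance
    p≢0 : ℚ.NonZero p
    p≢0 = ℚₚ.pos⇒nonZero p {{positive 0<p}}

-- The difference of the reciprocals is (q - p) / (p q), and p q ≥ δ².
reciprocal-close : ∀ {δ ε p q i j} → 0ℚ ℚ.< δ → δ ℚ.≤ p → δ ℚ.≤ q → i ℚ.* p ≡ 1ℚ → j ℚ.* q ≡ 1ℚ →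
                   ∣ q ℚ.- p ∣ ℚ.< ε ℚ.* (δ ℚ.* δ) → ∣ i ℚ.- j ∣ ℚ.< ε
reciprocal-close {δ} {ε} {p} {q} {i} {j} 0<δ δ≤p δ≤q ip≡1 jq≡1 q-p< =
  ℚₚ.*-cancelʳ-<-nonNeg (δ ℚ.* δ) {{nonNegative 0≤δδ}} (begin-strict
    ∣ i ℚ.- j ∣ ℚ.* (δ ℚ.* δ)        ≤⟨ ℚₚ.*-monoˡ-≤-nonNeg ∣ i ℚ.- j ∣
                                          {{nonNegative (ℚₚ.0≤∣p∣ (i ℚ.- j))}} δδ≤pq ⟩
    ∣ i ℚ.- j ∣ ℚ.* (p ℚ.* q)        ≡⟨ cong (∣ i ℚ.- j ∣ ℚ.*_) (ℚₚ.0≤p⇒∣p∣≡p (ℚₚ.≤-trans 0≤δδ δδ≤pq)) ⟨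
    ∣ i ℚ.- j ∣ ℚ.* ∣ p ℚ.* q ∣      ≡⟨ ℚₚ.∣p*q∣≡∣p∣*∣q∣ (i ℚ.- j) (p ℚ.* q) ⟨
    ∣ (i ℚ.- j) ℚ.* (p ℚ.* q) ∣      ≡⟨ cong ∣_∣ difference ⟩
    ∣ q ℚ.- p ∣                      <⟨ q-p< ⟩
    ε ℚ.* (δ ℚ.* δ)                  ∎)
  where
  open ℚₚ.≤-Reasoning
  0≤δ : 0ℚ ℚ.≤ δ
  0≤δ = ℚₚ.<⇒≤ 0<δ
  0≤δδ : 0ℚ ℚ.≤ δ ℚ.* δ
  0≤δδ = 0≤p*q 0≤δ 0≤δ
  δδ≤pq : δ ℚ.* δ ℚ.≤ p ℚ.* q
  δδ≤pq = ℚₚ.≤-trans (ℚₚ.*-monoˡ-≤-nonNeg δ {{nonNegative 0≤δ}} δ≤q)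
    (ℚₚ.*-monoʳ-≤-nonNeg q {{nonNegative (ℚₚ.≤-trans 0≤δ δ≤q)}} δ≤p)
  difference : (i ℚ.- j) ℚ.* (p ℚ.* q) ≡ q ℚ.- p
  difference = trans
    (solve 4 (λ i j p q → (i :- j) :* (p :* q) := i :* p :* q :- j :* q :* p) refl i j p q)
    (trans (cong₂ (λ s t → s ℚ.* q ℚ.- t ℚ.* p) ip≡1 jq≡1)
      (solve 2 (λ p q → con 1ℚ :* q :- con 1ℚ :* p := q :- p) refl p q))

above⇒invertible : ∀ {δ} → 0ℚ ℚ.< δ → ∀ x → EventuallyAbove δ x → ∃ λ y → x *ᴿ y ≈ᴿ fromℚᴿ 1ℚ
above⇒invertible {δ} 0<δ x (N , above) = mkℝ inv inv-cauchy , mk≈ᴿ λ ε 0<ε →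
  N , λ n N≤n → subst (λ p → ∣ p ℚ.- 1ℚ ∣ ℚ.< ε) (sym (x*inv≡1 n N≤n)) 0<ε
  where
  -- The truncation makes the inverse meaningful below N as well.
  truncated inv : Seq
  truncated n = seq x n ℚ.⊔ δ
  δ≤truncated : ∀ n → δ ℚ.≤ truncated n
  δ≤truncated n = ℚₚ.p≤q⊔p (seq x n) δ
  truncated≡ : ∀ n → N ℕ.≤ n → truncated n ≡ seq x n
  truncated≡ n N≤n = ℚₚ.p≥q⇒p⊔q≡p (above n N≤n)
  inv n = proj₁ (reciprocal (truncated n) (ℚₚ.<-≤-trans 0<δ (δ≤truncated n)))
  inv-inverse : ∀ n → inv n ℚ.* truncated n ≡ 1ℚ
  inv-inverse n = proj₂ (reciprocal (truncated n) (ℚₚ.<-≤-trans 0<δ (δ≤truncated n)))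
  x*inv≡1 : ∀ n → N ℕ.≤ n → seq x n ℚ.* inv n ≡ 1ℚ
  x*inv≡1 n N≤n = trans (cong (ℚ._* inv n) (sym (truncated≡ n N≤n)))
    (trans (ℚₚ.*-comm (truncated n) (inv n)) (inv-inverse n))
  inv-cauchy : Cauchy inv
  inv-cauchy ε 0<ε with cauchy x (ε ℚ.* (δ ℚ.* δ)) (0<p*q 0<ε (0<p*q 0<δ 0<δ))
  ... | M , close = N ℕ.⊔ M , λ m n le le′ →
    reciprocal-close {i = inv m} {j = inv n} 0<δ (δ≤truncated m) (δ≤truncated n) (inv-inverse m) (inv-inverse n)
      (subst (ℚ._< ε ℚ.* (δ ℚ.* δ))
        (sym (cong₂ (λ p q → ∣ p ℚ.- q ∣)
          (truncated≡ n (ℕₚ.m⊔n≤o⇒m≤o N M le′)) (truncated≡ m (ℕₚ.m⊔n≤o⇒m≤o N M le))))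
        (close n m (ℕₚ.m⊔n≤o⇒n≤o N M le′) (ℕₚ.m⊔n≤o⇒n≤o N M le)))

module C = CommutativeRing ℂ-commutativeRing

termwise : ∀ {z w} → (∀ n → seq (re z) n ≡ seq (re w) n) → (∀ n → seq (im z) n ≡ seq (im w) n) → z ≈ᶜ w
termwise p q = mk≈ᶜ (mk≈ᴿ (≗⇒~ p)) (mk≈ᴿ (≗⇒~ q))

fromℝ : ℝ → ℂ
fromℝ x = x +i fromℚᴿ 0ℚ

fromℝ-invertible : ∀ {x} → (∃ λ y → x *ᴿ y ≈ᴿ fromℚᴿ 1ℚ) → Invertible ℂ-commutativeRing (fromℝ x)
fromℝ-invertible {x} (y , xy≈1) = fromℝ y , C.trans
  (termwise {w = fromℝ (x *ᴿ y)}
    (λ n → solve 2 (λ x y → x :* y :- con 0ℚ :* con 0ℚ := x :* y) refl (seq x n) (seq y n))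
    (λ n → solve 2 (λ x y → x :* con 0ℚ :+ con 0ℚ :* y := con 0ℚ) refl (seq x n) (seq y n)))
  (mk≈ᶜ xy≈1 ≈ᴿ.refl)

norm² : ℂ → ℝ
norm² z = re z *ᴿ re z +ᴿ im z *ᴿ im z

norm²-invertible : ∀ {z} → (∃ λ y → norm² z *ᴿ y ≈ᴿ fromℚᴿ 1ℚ) → Invertible ℂ-commutativeRing z
norm²-invertible {z} (y , zz̄y≈1) = (re z *ᴿ y) +i (-ᴿ (im z *ᴿ y)) , C.trans
  (termwise {w = fromℝ (norm² z *ᴿ y)}
    (λ n → solve 3 (λ a b y → a :* (a :* y) :- b :* (:- (b :* y)) := (a :* a :+ b :* b) :* y)
      refl (seq (re z) n) (seq (im z) n) (seq y n))
    (λ n → solve 3 (λ a b y → a :* (:- (b :* y)) :+ b :* (a :* y) := con 0ℚ)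
      refl (seq (re z) n) (seq (im z) n) (seq y n)))
  (mk≈ᶜ zz̄y≈1 ≈ᴿ.refl)

ℂ-nontrivial : ¬ fromℚ 1ℚ ≈ᶜ fromℚ 0ℚ
ℂ-nontrivial 1≈0 = let N , f = seq~ (re≈ 1≈0) ½ (ℚₚ.positive⁻¹ ½) in
  ℚₚ.<-asym (f N ℕₚ.≤-refl) (from-yes (½ ℚₚ.<? 1ℚ))

¼ ⅛ : ℚ
¼ = ½ ℚ.* ½
⅛ = ½ ℚ.* ¼

close-above : ∀ {p q} → ¼ ℚ.≤ p → ∣ p ℚ.- q ∣ ℚ.< ⅛ → ⅛ ℚ.≤ q
close-above {p} {q} ¼≤p close = 0≤p-q⇒q≤p (subst (0ℚ ℚ.≤_)
  (solve 2 (λ p q → p :- con ¼ :+ (con ⅛ :- (p :- q)) := q :- con ⅛) refl p q)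
  (0≤p+q (q≤p⇒0≤p-q ¼≤p) (q≤p⇒0≤p-q (ℚₚ.≤-trans (p≤∣p∣ (p ℚ.- q)) (ℚₚ.<⇒≤ close)))))

close-complement : ∀ {p q} → p ℚ.≤ ¼ → ∣ p ℚ.+ q ℚ.- 1ℚ ∣ ℚ.< ½ → ¼ ℚ.≤ q
close-complement {p} {q} p≤¼ close = 0≤p-q⇒q≤p (subst (0ℚ ℚ.≤_)
  (solve 2 (λ p q → con ¼ :- p :+ (con ½ :- :- (p :+ q :- con 1ℚ)) := q :- con ¼) refl p q)
  (0≤p+q (q≤p⇒0≤p-q p≤¼) (q≤p⇒0≤p-q (ℚₚ.≤-trans (p≤∣p∣ (ℚ.- (p ℚ.+ q ℚ.- 1ℚ)))
    (ℚₚ.<⇒≤ (subst (ℚ._< ½) (sym (ℚₚ.∣-p∣≡∣p∣ (p ℚ.+ q ℚ.- 1ℚ))) close))))))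

stays-above : ∀ x N → (∀ m n → N ℕ.≤ m → N ℕ.≤ n → ∣ seq x m ℚ.- seq x n ∣ ℚ.< ⅛) →
              ∀ K → N ℕ.≤ K → ¼ ℚ.≤ seq x K → EventuallyAbove ⅛ x
stays-above x N close K N≤K ¼≤x =
  N , λ n N≤n → close-above ¼≤x (close K n N≤K N≤n)

-- The only decision concerns one rational, at an index K past all three moduli: either x is at
-- least ¼ there, or the sum being above ½ gives this for y. Other terms past the modulus differ by
-- less than ⅛ and so stay above ⅛.
half-above : ∀ {x y} → x +ᴿ y ≈ᴿ fromℚᴿ 1ℚ → EventuallyAbove ⅛ x ⊎ EventuallyAbove ⅛ y
half-above {x} {y} x+y≈1 = decide (¼ ℚₚ.≤? seq x K)
  where
  modulus-x = cauchy x ⅛ (ℚₚ.positive⁻¹ ⅛)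
  modulus-y = cauchy y ⅛ (ℚₚ.positive⁻¹ ⅛)
  modulus-+ = seq~ x+y≈1 ½ (ℚₚ.positive⁻¹ ½)
  L M N K : ℕ
  L = proj₁ modulus-+
  M = proj₁ modulus-x
  N = proj₁ modulus-y
  K = L ℕ.⊔ (M ℕ.⊔ N)
  decide : Dec (¼ ℚ.≤ seq x K) → EventuallyAbove ⅛ x ⊎ EventuallyAbove ⅛ y
  decide (yes ¼≤x) = inj₁ (stays-above x M (proj₂ modulus-x) K
    (ℕₚ.≤-trans (ℕₚ.m≤m⊔n M N) (ℕₚ.m≤n⊔m L _)) ¼≤x)
  decide (no  ¼≰x) = inj₂ (stays-above y N (proj₂ modulus-y) K
    (ℕₚ.≤-trans (ℕₚ.m≤n⊔m M N) (ℕₚ.m≤n⊔m L _))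
    (close-complement (ℚₚ.<⇒≤ (ℚₚ.≰⇒> ¼≰x)) (proj₂ modulus-+ K (ℕₚ.m≤m⊔n L _))))

re-above⇒invertible : ∀ {δ} → 0ℚ ℚ.< δ → ∀ z → EventuallyAbove δ (re z) → Invertible ℂ-commutativeRing z
re-above⇒invertible {δ} 0<δ z (N , above) = norm²-invertible {z}
  (above⇒invertible (0<p*q 0<δ 0<δ) (norm² z) (N , λ n N≤n → square-above (seq (im z) n) (above n N≤n)))
  where
  square-above : ∀ {p} q → δ ℚ.≤ p → δ ℚ.* δ ℚ.≤ p ℚ.* p ℚ.+ q ℚ.* q
  square-above {p} q δ≤p = subst (ℚ._≤ p ℚ.* p ℚ.+ q ℚ.* q) (ℚₚ.+-identityʳ (δ ℚ.* δ)) (ℚₚ.+-mono-≤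
    (ℚₚ.≤-trans (ℚₚ.*-monoˡ-≤-nonNeg δ {{nonNegative (ℚₚ.<⇒≤ 0<δ)}} δ≤p)
      (ℚₚ.*-monoʳ-≤-nonNeg p {{nonNegative (ℚₚ.≤-trans (ℚₚ.<⇒≤ 0<δ) δ≤p)}} δ≤p))
    (0≤p*p q))

-- The real parts already add up to 1, and a lower bound on a real part bounds the norm from below.
ℂ-local : Local ℂ-commutativeRing
ℂ-local z w z+w≈1 = ⊎.map (re-above⇒invertible (ℚₚ.positive⁻¹ ⅛) z) (re-above⇒invertible (ℚₚ.positive⁻¹ ⅛) w)
  (half-above (re≈ z+w≈1))

-- A primitive root of unity in ℂ

module _ (x : ℝ) where

  private
    U : ℕ → ℂ
    U j = fromℝ (uᴿ x j)

  U-rec : ∀ j → U (2 ℕ.+ j) +ᶜ U j ≈ᶜ fromℝ x *ᶜ U (suc j)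
  U-rec j = termwise
    (λ n → solve 3 (λ x a b → x :* a :- b :+ b := x :* a :- con 0ℚ :* con 0ℚ) refl
      (seq x n) (seq (uᴿ x (suc j)) n) (seq (uᴿ x j) n))
    (λ n → solve 2 (λ x a → con 0ℚ :+ con 0ℚ := x :* con 0ℚ :+ con 0ℚ :* a) refl
      (seq x n) (seq (uᴿ x (suc j)) n))

  private
    U* : ∀ i j → U i *ᶜ U j ≈ᶜ fromℝ (uᴿ x i *ᴿ uᴿ x j)
    U* i j = termwise
      (λ n → solve 2 (λ a b → a :* b :- con 0ℚ :* con 0ℚ := a :* b) refl (seq (uᴿ x i) n) (seq (uᴿ x j) n))
      (λ n → solve 2 (λ a b → a :* con 0ℚ :+ con 0ℚ :* b := con 0ℚ) refl (seq (uᴿ x i) n) (seq (uᴿ x j) n))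

    U+ : ∀ a b → fromℝ a +ᶜ fromℝ b ≈ᶜ fromℝ (a +ᴿ b)
    U+ a b = termwise (λ n → refl) (λ n → refl)

    fromℝ-cong : ∀ {a b} → (∀ n → seq a n ≡ seq b n) → fromℝ a ≈ᶜ fromℝ b
    fromℝ-cong eq = mk≈ᶜ (mk≈ᴿ (≗⇒~ eq)) ≈ᴿ.refl

    seq-U* : ∀ i j n → seq (uᴿ x i *ᴿ uᴿ x j) n ≡ u (seq x n) i ℚ.* u (seq x n) j
    seq-U* i j n = cong₂ ℚ._*_ (seq-uᴿ x i n) (seq-uᴿ x j n)

  U-cassini : ∀ j → U (suc j) *ᶜ U (suc j) ≈ᶜ fromℚ 1ℚ +ᶜ U (2 ℕ.+ j) *ᶜ U j
  U-cassini j = C.trans (U* (suc j) (suc j)) (C.trans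
    (fromℝ-cong {b = fromℚᴿ 1ℚ +ᴿ uᴿ x (2 ℕ.+ j) *ᴿ uᴿ x j} λ n → trans (seq-U* (suc j) (suc j) n)
      (trans (u-cassini (seq x n) j) (cong (1ℚ ℚ.+_) (sym (seq-U* (2 ℕ.+ j) j n)))))
    (C.sym (C.trans (C.+-congˡ (U* (2 ℕ.+ j) j)) (U+ (fromℚᴿ 1ℚ) (uᴿ x (2 ℕ.+ j) *ᴿ uᴿ x j)))))

  -- The addition formula gives u (2j + 2) = u (j + 1) (u (j + 2) - u j). The common factor is
  -- cancelled in `primitive-root`, where it is invertible.
  U-double : ∀ j → U (suc j ℕ.+ suc j) ≈ᶜ fromℚ 0ℚ → U (suc j) *ᶜ U (2 ℕ.+ j) ≈ᶜ U (suc j) *ᶜ U j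
  U-double j U≈0 = C.trans (U* (suc j) (2 ℕ.+ j)) (C.trans
    (fromℝ-cong {b = uᴿ x (suc j ℕ.+ suc j) +ᴿ uᴿ x (suc j) *ᴿ uᴿ x j} λ n → trans (seq-U* (suc j) (2 ℕ.+ j) n)
      (trans (solve 3 (λ a b c → a :* c := a :* c :- b :* a :+ a :* b) refl
                (u (seq x n) (suc j)) (u (seq x n) j) (u (seq x n) (2 ℕ.+ j)))
        (sym (cong₂ ℚ._+_
          (trans (seq-uᴿ x (suc j ℕ.+ suc j) n) (u-+ (seq x n) j (suc j))) (seq-U* (suc j) j n)))))
    (C.trans (C.sym (U+ (uᴿ x (suc j ℕ.+ suc j)) (uᴿ x (suc j) *ᴿ uᴿ x j)))
      (C.trans (C.+-congʳ U≈0)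
        (C.trans (C.+-identityˡ (fromℝ (uᴿ x (suc j) *ᴿ uᴿ x j))) (C.sym (U* (suc j) j))))))

u-zero : ∀ k → ∃ λ x → uᴿ x (2 ℕ.+ k) ≈ᴿ fromℚᴿ 0ℚ ×
         (∀ j → j ℕ.< suc k → ∃ λ y → uᴿ x (suc j) *ᴿ y ≈ᴿ fromℚᴿ 1ℚ)
u-zero k = from-isolating (isolating k)
  where
  from-isolating : ∃ (Isolates k) → _
  from-isolating (q , isolates) = root , u-root≈0 , λ j j<1+k →
    above⇒invertible (proj₁ isolates j j<1+k) (uᴿ root (suc j))
      (0 , λ n _ → subst (u q (suc j) ℚ.≤_) (sym (seq-uᴿ root (suc j) n)) (u-root-bound n j j<1+k))
    where open Root isolates

ℂ-primitive-root : ∀ h′ → ∃ λ ζ → ζ ^ᶜ suc h′ ≈ᶜ fromℚ 1ℚ ×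
                   (∀ j → 0 ℕ.< j → j ℕ.< suc h′ → Apart ℂ-commutativeRing (ζ ^ᶜ j) (fromℚ 1ℚ))
-- The index k + 2 of the vanishing value has to be 2h.
ℂ-primitive-root h′ = from-zero (u-zero (h′ ℕ.+ h′))
  where
  2h≡2+k : 2 ℕ.* suc h′ ≡ 2 ℕ.+ (h′ ℕ.+ h′)
  2h≡2+k = cong suc (trans (cong (λ n → h′ ℕ.+ suc n) (ℕₚ.+-identityʳ h′)) (ℕₚ.+-suc h′ h′))
  from-zero : (∃ λ x → uᴿ x (2 ℕ.+ (h′ ℕ.+ h′)) ≈ᴿ fromℚᴿ 0ℚ ×
               (∀ j → j ℕ.< suc (h′ ℕ.+ h′) → ∃ λ y → uᴿ x (suc j) *ᴿ y ≈ᴿ fromℚᴿ 1ℚ)) → _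
  from-zero (x , ux≈0 , ux-invertible) = primitive-root ℂ-commutativeRing
    {fromℝ x} {fromℚᴿ 0ℚ +i fromℚᴿ 1ℚ} {fromℚᴿ 0ℚ +i fromℚᴿ (ℚ.- 1ℚ)} {fromℚ ½}
    (λ j → fromℝ (uᴿ x j)) C.refl C.refl (U-rec x)
    (termwise (λ _ → refl) (λ _ → refl)) (termwise (λ _ → refl) (λ _ → refl))
    (termwise (λ _ → refl) (λ _ → refl))
    h′ (U-cassini x h′) (U-double x h′ (u≈0 _ (cong suc (ℕₚ.+-suc h′ h′)))) (u≈0 _ 2h≡2+k) u-invertible
    where
    u≈0 : ∀ n → n ≡ 2 ℕ.+ (h′ ℕ.+ h′) → fromℝ (uᴿ x n) ≈ᶜ fromℚ 0ℚ
    u≈0 _ refl = mk≈ᶜ ux≈0 (re≈ (C.refl {fromℚ 0ℚ}))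
    u-invertible : ∀ j → 0 ℕ.< j → j ℕ.< 2 ℕ.* suc h′ → Invertible ℂ-commutativeRing (fromℝ (uᴿ x j))
    u-invertible (suc j) _ j<2h = fromℝ-invertible (ux-invertible j (ℕ.s≤s⁻¹ (subst (suc j ℕ.<_) 2h≡2+k j<2h)))

-- The formula over ℂ

fromℚ-cong : ∀ {p q} → p ≡ q → fromℚ p ≈ᶜ fromℚ q
fromℚ-cong refl = C.refl

open Mult (CommutativeRing.semiring ℂ-commutativeRing) using () renaming (_×_ to _·ᶜ_)

fromℕ≈·1 : ∀ n → fromℕ n ≈ᶜ n ·ᶜ fromℚ 1ℚ
fromℕ≈·1 zero    = fromℚ-cong refl
fromℕ≈·1 (suc n) = C.trans (fromℚ-cong (suc/1 n)) (C.trans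
  (termwise {w = fromℚ 1ℚ +ᶜ fromℕ n} (λ _ → refl) (λ _ → refl))
  (C.+-congˡ {fromℚ 1ℚ} (fromℕ≈·1 n)))

h/1*1/h≡1 : ∀ h′ → + suc h′ ℚ./ 1 ℚ.* (+ 1 ℚ./ suc h′) ≡ 1ℚ
h/1*1/h≡1 h′ = trans (cong₂ ℚ._*_ (n/1≡mkℚ (suc h′)) (ℚₚ.↥p/↧p≡p (mkℚ (+ 1) h′ (1-coprimeTo (suc h′)))))
  (ℚₚ.*-inverseʳ (mkℚ (+ suc h′) 0 (coprime-sym (1-coprimeTo (suc h′)))))

module _ {c ℓ} (G : AbelianGroup c ℓ) {h′ : ℕ} (∣G∣≡h : HasCardinality (AbelianGroup.setoid G) (suc h′)) where

  order*1/order≈1 : suc h′ ·ᶜ fromℚ 1ℚ *ᶜ 1/order G ∣G∣≡h ≈ᶜ fromℚ 1ℚ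
  order*1/order≈1 = C.trans (C.*-congʳ {1/order G ∣G∣≡h} (C.sym (fromℕ≈·1 (suc h′))))
    (C.trans (termwise {w = fromℚ (+ suc h′ ℚ./ 1 ℚ.* (+ 1 ℚ./ suc h′))}
      (λ _ → trans (cong (λ q → + suc h′ ℚ./ 1 ℚ.* (+ 1 ℚ./ suc h′) ℚ.- q) (ℚₚ.*-zeroˡ 0ℚ)) (ℚₚ.+-identityʳ _))
      (λ _ → trans (cong₂ ℚ._+_ (ℚₚ.*-zeroʳ (+ suc h′ ℚ./ 1)) (ℚₚ.*-zeroˡ (+ 1 ℚ./ suc h′))) (ℚₚ.+-identityʳ 0ℚ)))
      (fromℚ-cong (h/1*1/h≡1 h′)))

  ℂ-rootsOfUnity : RootsOfUnity ℂ-commutativeRing (suc h′)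
  ℂ-rootsOfUnity = from-root (ℂ-primitive-root h′)
    where
    from-root : (∃ λ ζ → ζ ^ᶜ suc h′ ≈ᶜ fromℚ 1ℚ ×
      (∀ j → 0 ℕ.< j → j ℕ.< suc h′ → Apart ℂ-commutativeRing (ζ ^ᶜ j) (fromℚ 1ℚ))) →
      RootsOfUnity ℂ-commutativeRing (suc h′)
    from-root (ζ , ζʰ≈1 , ζ-apart) = primitive⇒rootsOfUnity ℂ-commutativeRing ℂ-nontrivial ℂ-local (s≤s z≤n)
      order*1/order≈1 ζʰ≈1 ζ-apart

  module _ (roots : RootsOfUnity ℂ-commutativeRing (suc h′)) where

    open Fourier G ∣G∣≡h roots

    Charˢ↔Dual : Inverse Charˢ (Dual G)
    Charˢ↔Dual = record
      { to        = λ χ → record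
        { ⟦_⟧ = λ x → mkUnit (χ ⟪ x ⟫) (χ ⟪ x ⁻¹ ⟫) (χ-inverseʳ χ x)
        ; isGroupHomomorphism = record
          { isMonoidHomomorphism = record
            { isMagmaHomomorphism = record
              { isRelHomomorphism = record { cong = χ-cong χ }
              ; homo = χ-∙ χ
              }
            ; ε-homo = χ-ε χ
            }
          -- Holds by definition, as the inverse stored in the unit is χ (x ⁻¹).
          ; ⁻¹-homo = λ x → C.refl
          }
        }
      ; from      = λ χ → let open GroupHomomorphism χ in record
        { _⟪_⟫ = χ ⟨_⟩ ; χ-cong = ⟦⟧-cong ; χ-∙ = homo ; χ-ε = ε-homo }
      ; to-cong   = λ χ≈ψ → χ≈ψ
      ; from-cong = λ χ≈ψ → χ≈ψ
      ; inverse   = (λ χ≈ψ → χ≈ψ) , (λ χ≈ψ → χ≈ψ)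
      }
      where
      open Char
      open AbelianGroup G using (_⁻¹)

    dual-finite : Finite (Dual G)
    dual-finite = proj₁ characters-finite ,
      Composition.inverse (Symmetry.inverse Charˢ↔Dual) (proj₂ characters-finite)

    zeroSumCount≈ : ∀ {g} (r : Vector (AbelianGroup.Carrier G) g) (e : Vector ℕ g) (finite : Finite (Dual G)) →
      fromℕ (zeroSumCount G ∣G∣≡h r e) ≈ᶜ
      1/order G ∣G∣≡h *ᶜ sumOver finite (λ χ →
        ∏ (λ (i : Fin g) → ∑ (λ (k : Fin (suc (e i))) → χ ⟨ r i ⟩ ^ᶜ toℕ k)))
    zeroSumCount≈ r e finite = C.trans (fromℕ≈·1 (zeroSumCount G ∣G∣≡h r e))
      -- The given enumeration of the dual is transported to `Charˢ`, so the formula holds for every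
      -- enumeration and its sum is `sumOver finite` by definition.
      (Inversion.zeroSumCount-formula (proj₁ finite , Composition.inverse Charˢ↔Dual (proj₂ finite))
        {1/order G ∣G∣≡h} order*1/order≈1 r e)

theorem2 : ∀ {c ℓ} (G : AbelianGroup c ℓ) →
    let open AbelianGroup G in
    (h : ℕ) (∣G∣≡h : HasCardinality setoid h) →
    (g : ℕ) (r : Vector Carrier g) (e : Vector ℕ g) →
    Finite (Dual G) ×
    ((finite : Finite (Dual G)) →
    fromℕ (zeroSumCount G ∣G∣≡h r e) ≈ᶜ
    1/order G ∣G∣≡h *ᶜ
    sumOver finite (λ χ →
    ∏ (λ (i : Fin g) →
    ∑ (λ (k : Fin (suc (e i))) → χ ⟨ r i ⟩ ^ᶜ toℕ k))))
theorem2 G zero     ∣G∣≡h g r e = ⊥-elim (Finₚ.¬Fin0 (Inverse.to ∣G∣≡h (AbelianGroup.ε G)))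
theorem2 G (suc h′) ∣G∣≡h g r e = dual-finite G ∣G∣≡h roots , zeroSumCount≈ G ∣G∣≡h roots r e
  where
  roots : RootsOfUnity ℂ-commutativeRing (suc h′)
  roots = ℂ-rootsOfUnity G ∣G∣≡h
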